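{- Let $0<p\le1$ be a constant and $0<\varepsilon<(p/4)^{16}$. There is a constant $n_0$ such that for every natural number $n\ge n_0$, every graph $G\in\mathcal{Q}(n^{(2)},p,\varepsilon)$ admits a $10\varepsilon$-near quadrangular embedding.
   Context: Cut distance: for edge-weighted graphs $G,H$ on the same vertex set $V$, $\mathsf{d}_\square(G,H)=\max_{U,W\subseteq V}|\mathsf{e}_G(U,W)-\mathsf{e}_H(U,W)|/|V|^2$, with $\mathsf{e}_G(U,W)$ the total weight of edges with one endvertex in $U$ and the other in $W$. $K(n^{(2)},p)$ is the weighted complete bipartite graph on $V_1\sqcup V_2$, $|V_1|=|V_2|=n$, all edges between $V_1$ and $V_2$ having weight $p$. $\mathcal{Q}(n^{(2)},p,\varepsilon)$ is the set of graphs $G$ on vertex set $V_1\sqcup V_2$ (after a suitable identification) with $\mathsf{d}_\square(G,K(n^{(2)},p))<\varepsilon$. An embedding is a 2-cell embedding in an orientable surface (rotation system). For $\delta>0$ an embedding is $\delta$-near quadrangular if all but at most $2\delta|E(G)|$ edges of $G$ belong to two quadrangular faces (faces bounded by cycles of length 4).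
   Formalization: The constants p and ε are taken to be rational numbers instead of real numbers. -}

module Defs where

open import Data.Nat as ℕ using (ℕ; zero; suc; _+_)
open import Data.Integer using (+_)
open import Data.Rational as ℚ using (ℚ; 0ℚ; 1ℚ; _/_; ∣_∣)
open import Data.Fin using (Fin; toℕ)
open import Data.Fin.Properties using (_≟_)
open import Data.Bool using (Bool; true; false; _∧_; not; if_then_else_)
open import Data.List using (List; []; _∷_; map; foldr; concatMap; filter; length)
open import Data.List using (allFin)
open import Data.Vec using (Vec; []; _∷_; lookup)
open import Data.Product using (_×_; _,_; proj₁; proj₂; ∃-syntax)
open import Function using (_∘_)
open import Relation.Nullary.Decidable using (⌊_⌋)
open import Relation.Binary.PropositionalEquality using (_≡_)

ℕtoℚ : ℕ → ℚ
ℕtoℚ k = + k / 1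

_^ℚ_ : ℚ → ℕ → ℚ
q ^ℚ zero  = 1ℚ
q ^ℚ suc k = q ℚ.* (q ^ℚ k)

sumℚ : List ℚ → ℚ
sumℚ = foldr ℚ._+_ 0ℚ

-- maximum of a list of rationals (0 for the empty list; all values
-- used below are absolute values, hence ≥ 0)
maxℚ : List ℚ → ℚ
maxℚ = foldr ℚ._⊔_ 0ℚ

record SimpleGraph (m : ℕ) : Set where
  field
    adj    : Fin m → Fin m → Bool
    sym    : ∀ u v → adj u v ≡ adj v u
    irrefl : ∀ u → adj u u ≡ false
open SimpleGraph public

-- edge-weighted graphs on Fin m, given by a (symmetric) weight function
WGraph : ℕ → Set
WGraph m = Fin m → Fin m → ℚ

weightOf : ∀ {m} → SimpleGraph m → WGraph m
weightOf G u v = if adj G u v then 1ℚ else 0ℚ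

Subset : ℕ → Set
Subset m = Vec Bool m

allSubsets : (m : ℕ) → List (Subset m)
allSubsets zero    = [] ∷ []
allSubsets (suc m) = concatMap (λ s → (true ∷ s) ∷ (false ∷ s) ∷ []) (allSubsets m)

eW : ∀ {m} → WGraph m → Subset m → Subset m → ℚ
eW {m} w U W =
  sumℚ (map (λ u → sumℚ (map (λ v →
      if lookup U u ∧ lookup W v then w u v else 0ℚ) (allFin m))) (allFin m))

-- normalisation by |V|^2 (the empty vertex set gives 0)
divBySq : ℕ → ℚ → ℚ
divBySq zero    x = 0ℚ
divBySq (suc k) x = x ℚ.* (+ 1 / (suc k ℕ.* suc k))

cutDist : ∀ {m} → WGraph m → WGraph m → ℚ
cutDist {m} g h =
  divBySq m (maxℚ (concatMap (λ U → map (λ W → ∣ eW g U W ℚ.- eW h U W ∣)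
                     (allSubsets m)) (allSubsets m)))

-- The weighted complete bipartite graph K(n^(2), p) on Fin (n + n),
-- with V₁ = {i | toℕ i < n} and V₂ = {i | toℕ i ≥ n}.

inV₁ : ∀ {n} → Fin (n + n) → Bool
inV₁ {n} i = ⌊ toℕ i ℕ.<? n ⌋

Kbip : (n : ℕ) → ℚ → WGraph (n + n)
Kbip n p u v = if (inV₁ {n} u ∧ not (inV₁ {n} v)) Data.Bool.∨ (inV₁ {n} v ∧ not (inV₁ {n} u))
               then p else 0ℚ

InQ : (n : ℕ) → ℚ → ℚ → SimpleGraph (n + n) → Set
InQ n p ε G = cutDist (weightOf G) (Kbip n p) ℚ.< ε

-- Embeddings = rotation systems

iterate : ∀ {A : Set} → (A → A) → ℕ → A → A
iterate f zero    x = x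
iterate f (suc k) x = f (iterate f k x)

-- A rotation system: for each vertex u, `next u` restricts to a cyclic
-- permutation of the neighbourhood N(u) (values outside N(u) are irrelevant).
record Rotation {m : ℕ} (G : SimpleGraph m) : Set where
  field
    next     : Fin m → Fin m → Fin m
    next-adj : ∀ u v → adj G u v ≡ true → adj G u (next u v) ≡ true
    next-inj : ∀ u v w → adj G u v ≡ true → adj G u w ≡ true →
               next u v ≡ next u w → v ≡ w
    next-cyc : ∀ u v w → adj G u v ≡ true → adj G u w ≡ true →
               ∃[ k ] iterate (next u) k v ≡ w
open Rotation public

Dart : ℕ → Set
Dart m = Fin m × Fin m

faceStep : ∀ {m} {G : SimpleGraph m} → Rotation G → Dart m → Dart m
faceStep R (u , v) = (v , next R v u)

_≠ᵇ_ : ∀ {m} → Fin m → Fin m → Bool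
a ≠ᵇ b = not ⌊ a ≟ b ⌋

_≡ᵇ_ : ∀ {m} → Dart m → Dart m → Bool
(a , b) ≡ᵇ (c , d) = ⌊ a ≟ c ⌋ ∧ ⌊ b ≟ d ⌋

-- the dart d lies on a quadrangular face: its facial walk closes after
-- 4 steps and visits 4 distinct vertices (i.e. it is bounded by a 4-cycle)
onQuadFace : ∀ {m} {G : SimpleGraph m} → Rotation G → Dart m → Bool
onQuadFace R d =
  let d1 = faceStep R d ; d2 = faceStep R d1 ; d3 = faceStep R d2 ; d4 = faceStep R d3
      a = proj₁ d ; b = proj₁ d1 ; c = proj₁ d2 ; e = proj₁ d3
  in (d4 ≡ᵇ d) ∧ (a ≠ᵇ b) ∧ (a ≠ᵇ c) ∧ (a ≠ᵇ e) ∧ (b ≠ᵇ c) ∧ (b ≠ᵇ e) ∧ (c ≠ᵇ e)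

edgeList : ∀ {m} → SimpleGraph m → List (Dart m)
edgeList {m} G =
  concatMap (λ u → concatMap (λ v →
      if adj G u v ∧ ⌊ toℕ u ℕ.<? toℕ v ⌋ then (u , v) ∷ [] else [])
    (allFin m)) (allFin m)

badEdges : ∀ {m} {G : SimpleGraph m} → Rotation G → List (Dart m)
badEdges {G = G} R =
  filter (λ e → not (onQuadFace R e ∧ onQuadFace R (proj₂ e , proj₁ e)) Data.Bool.≟ true)
         (edgeList G)

NearQuadrangular : ∀ {m} {G : SimpleGraph m} → Rotation G → ℚ → Set
NearQuadrangular {G = G} R δ =
  ℕtoℚ (length (badEdges R)) ℚ.≤ (ℕtoℚ 2 ℚ.* δ ℚ.* ℕtoℚ (length (edgeList G)))

{-# OPTIONS --safe #-}
-- The cut distance is used only to see that G has at least (p/2)n² edges: for n large,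
-- every graph on m vertices has a rotation system in which all but o(m²) edges lie on two
-- quadrangles. By Kővári–Sós–Turán, all but o(m²) edges can be removed greedily as
-- edge-disjoint copies of K_{s,s}, with s a large constant. In a copy with sides a and b,
-- list b₀, …, b_{s-1} around a_i, in reverse if i is odd, and symmetrically around b_j. The
-- rotation at a vertex is the concatenation of these blocks, closed up cyclically. Then
-- a_i b_j lies on two quadrangles unless i or j is 0 or s-1, which loses O(s) of the s²
-- edges of the copy.

module Submission where

open import Defs
open import Data.Bool as Bool using (Bool; true; false; not; _∧_; _∨_; if_then_else_)
open import Data.Bool.Properties using (not-involutive; ∨-comm; ∧-comm; ∧-identityʳ)
open import Data.Empty using (⊥; ⊥-elim)
open import Data.Fin as Fin using (Fin; toℕ)
open import Data.List using (List; []; _∷_; _++_; map; concatMap; filter; length; take; drop; tabulate; allFin; applyUpTo; applyDownFrom)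
open import Data.List.Membership.Propositional using (_∈_; lose)
open import Data.List.Membership.Propositional.Properties using (∈-filter⁺; ∈-filter⁻; ∈-allFin; ∈-applyUpTo⁺; ∈-applyUpTo⁻; ∈-applyDownFrom⁺; ∈-applyDownFrom⁻; ∈-++⁺ˡ; ∈-++⁺ʳ; ∈-++⁻; ∈-concatMap⁺; ∈-map⁺)
open import Data.List.Properties using (length-take; length-drop; length-tabulate; length-++; take++drop≡id; map-++; map-tabulate; filter-++)
open import Data.List.Relation.Unary.All as All using (_∷_)
open import Data.List.Relation.Unary.AllPairs using ([]; _∷_)
open import Data.List.Relation.Unary.Any using (here; there)
open import Data.List.Relation.Unary.Unique.Propositional using (Unique)
open import Data.List.Relation.Unary.Unique.Propositional.Properties using (filter⁺; take⁺; drop⁺; allFin⁺; ++⁺; applyUpTo⁺₁; applyDownFrom⁺₁)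
open import Data.Nat as ℕ using (ℕ; zero; suc; NonZero)
open import Data.Nat.ListAction using (sum)
open import Data.Nat.ListAction.Properties using (sum-++)
import Data.Nat.Properties as ℕ
open import Data.Nat.Tactic.RingSolver using (solve-∀)
open import Data.Product using (Σ; _×_; _,_; proj₁; proj₂; ∃-syntax)
open import Data.Sum using (_⊎_; inj₁; inj₂)
open import Function using (_∘_)
open import Relation.Binary.PropositionalEquality as ≡ using (_≡_; _≢_; refl; cong; cong₂; subst; subst₂; trans)
open import Relation.Nullary using (¬_; Dec; yes; no; does)
open import Relation.Nullary.Decidable using (_×-dec_; _⊎-dec_; dec-true; dec-false; ⌊_⌋; isYes≗does; from-yes)

-- A quadrangle is certified by four pairs of consecutive list entries, never by the step that
-- closes a list up. Concatenation keeps such pairs, so a copy can be put back without regard to the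
-- rest of the rotation, and a price is paid only at the ends of its blocks. All counting is over
-- darts, with `N` at least 1/(εp) and the target m²/N. A copy removes 2s² darts and spoils at most
-- 8s of them, a fraction 4/s, so `s = 8 * N` keeps the total spoiled by copies within m²/(2N). The
-- graph at which the greedy search stops has at most m²/(2N) darts as soon as m is at least
-- 2^(8sN). With m = 2n the bad edges number at most 4n²/N ≤ 4εpn², and pn² is at most 2e(G); this
-- gives 8εe(G) against the permitted 20εe(G).

private variable
  A : Set
  m : ℕ

module _ where

  open import Data.Fin.Properties using (_≟_)
  open import Data.Nat hiding (_≟_; _≡ᵇ_)
  open import Data.Nat.DivMod using (m≡m%n+[m/n]*n; m%n<n; m/n*n≤m)
  open import Data.Nat.Properties hiding (_≟_)

  -- Finite sums

  𝟙 : Bool → ℕ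
  𝟙 false = 0
  𝟙 true  = 1

  𝟙≤1 : ∀ b → 𝟙 b ≤ 1
  𝟙≤1 false = z≤n
  𝟙≤1 true  = ≤-refl

  ∑ : List A → (A → ℕ) → ℕ
  ∑ l f = sum (map f l)

  ∑-mono : ∀ (l : List A) {f g : A → ℕ} → (∀ x → f x ≤ g x) → ∑ l f ≤ ∑ l g
  ∑-mono []      _   = z≤n
  ∑-mono (x ∷ l) f≤g = +-mono-≤ (f≤g x) (∑-mono l f≤g)

  ∑-cong : ∀ (l : List A) {f g : A → ℕ} → (∀ x → f x ≡ g x) → ∑ l f ≡ ∑ l g
  ∑-cong []      _   = refl
  ∑-cong (x ∷ l) f≡g = cong₂ _+_ (f≡g x) (∑-cong l f≡g)

  ∑-distrib-+ : ∀ (l : List A) (f g : A → ℕ) → ∑ l (λ x → f x + g x) ≡ ∑ l f + ∑ l g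
  ∑-distrib-+ []      f g = refl
  ∑-distrib-+ (x ∷ l) f g rewrite ∑-distrib-+ l f g = shuffle (f x) (g x) (∑ l f) (∑ l g)
    where
    shuffle : ∀ a b c d → (a + b) + (c + d) ≡ (a + c) + (b + d)
    shuffle = solve-∀

  ∑-*ʳ : ∀ (l : List A) (f : A → ℕ) c → ∑ l (λ x → f x * c) ≡ ∑ l f * c
  ∑-*ʳ []      f c = refl
  ∑-*ʳ (x ∷ l) f c rewrite ∑-*ʳ l f c = ≡.sym (*-distribʳ-+ c (f x) (∑ l f))

  ∑-*ˡ : ∀ (l : List A) c (f : A → ℕ) → ∑ l (λ x → c * f x) ≡ c * ∑ l f
  ∑-*ˡ l c f = trans (∑-cong l (λ x → *-comm c (f x))) (trans (∑-*ʳ l f c) (*-comm (∑ l f) c))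

  ∑-const : ∀ (l : List A) c → ∑ l (λ _ → c) ≡ length l * c
  ∑-const []      c = refl
  ∑-const (x ∷ l) c = cong (c +_) (∑-const l c)

  ∑-++ : ∀ (k l : List A) (f : A → ℕ) → ∑ (k ++ l) f ≡ ∑ k f + ∑ l f
  ∑-++ k l f = trans (cong sum (map-++ f k l)) (sum-++ (map f k) (map f l))

  ∑-tabulate : ∀ {k} (g : Fin k → A) (f : A → ℕ) → ∑ (tabulate g) f ≡ ∑ (allFin k) (f ∘ g)
  ∑-tabulate g f = cong sum (trans (map-tabulate g f) (≡.sym (map-tabulate (λ i → i) (f ∘ g))))

  ∑-0 : ∀ (l : List A) → ∑ l (λ _ → 0) ≡ 0
  ∑-0 l = trans (∑-const l 0) (*-zeroʳ (length l))

  ∑-point : (x : Fin m) → ∑ (allFin m) (λ u → 𝟙 (does (x ≟ u))) ≡ 1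
  ∑-point {suc m} Fin.zero = cong suc (trans (∑-tabulate {k = m} Fin.suc (λ u → 𝟙 (does (Fin.zero ≟ u)))) (∑-0 (allFin m)))
  ∑-point {suc m} (Fin.suc x) = trans (∑-tabulate {k = m} Fin.suc (λ u → 𝟙 (does (Fin.suc x ≟ u)))) (∑-point x)

  length-concatMap : ∀ {B : Set} (f : A → List B) l → length (concatMap f l) ≡ ∑ l (length ∘ f)
  length-concatMap f []      = refl
  length-concatMap f (x ∷ l) = trans (length-++ (f x)) (cong (length (f x) +_) (length-concatMap f l))

  length-filter-concatMap : ∀ {A B : Set} {P : B → Set} (P? : ∀ x → Dec (P x)) (f : A → List B) l →
    length (filter P? (concatMap f l)) ≡ ∑ l (λ x → length (filter P? (f x)))
  length-filter-concatMap P? f []      = refl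
  length-filter-concatMap P? f (x ∷ l) = begin
    length (filter P? (f x ++ concatMap f l))                  ≡⟨ cong length (filter-++ P? (f x) _) ⟩
    length (filter P? (f x) ++ filter P? (concatMap f l))      ≡⟨ length-++ (filter P? (f x)) ⟩
    length (filter P? (f x)) + length (filter P? (concatMap f l)) ≡⟨ cong (_ +_) (length-filter-concatMap P? f l) ⟩
    _ ∎
    where open ≡.≡-Reasoning

  ∬ : (Fin m → Fin m → ℕ) → ℕ
  ∬ {m} f = ∑ (allFin m) (λ u → ∑ (allFin m) (f u))

  ∬-mono : {f g : Fin m → Fin m → ℕ} → (∀ u v → f u v ≤ g u v) → ∬ f ≤ ∬ g
  ∬-mono {m} f≤g = ∑-mono (allFin m) (λ u → ∑-mono (allFin m) (f≤g u))

  ∬-distrib-+ : (f g : Fin m → Fin m → ℕ) → ∬ (λ u v → f u v + g u v) ≡ ∬ f + ∬ g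
  ∬-distrib-+ {m} f g = trans (∑-cong (allFin m) (λ u → ∑-distrib-+ (allFin m) (f u) (g u)))
                              (∑-distrib-+ (allFin m) _ _)

  ∬-product : (f g : Fin m → ℕ) → ∬ (λ u v → f u * g v) ≡ ∑ (allFin m) f * ∑ (allFin m) g
  ∬-product {m} f g = trans (∑-cong (allFin m) (λ u → ∑-*ˡ (allFin m) (f u) g))
                            (∑-*ʳ (allFin m) f (∑ (allFin m) g))

  length-allFin : ∀ m → length (allFin m) ≡ m
  length-allFin m = length-tabulate {n = m} (λ i → i)

  ∬-𝟙≤ : (f : Fin m → Fin m → Bool) → ∬ (λ u v → 𝟙 (f u v)) ≤ m * m
  ∬-𝟙≤ {m} f = begin
    ∬ (λ u v → 𝟙 (f u v))          ≤⟨ ∬-mono (λ u v → 𝟙≤1 (f u v)) ⟩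
    ∬ {m} (λ u v → 1 * 1)           ≡⟨ ∬-product {m} (λ _ → 1) (λ _ → 1) ⟩
    ∑ (allFin m) (λ _ → 1) * ∑ (allFin m) (λ _ → 1) ≡⟨ cong₂ _*_ one one ⟩
    m * m                           ∎
    where
    open ≤-Reasoning
    one : ∑ (allFin m) (λ _ → 1) ≡ m
    one = trans (∑-const (allFin m) 1) (trans (*-identityʳ _) (length-allFin m))

  -- Kővári–Sós–Turán

  edges : (A → A → Bool) → List A → List A → ℕ
  edges f T W = ∑ T (λ u → ∑ W (λ w → 𝟙 (f u w)))

  edges≤ : ∀ (f : A → A → Bool) T W → edges f T W ≤ length T * length W
  edges≤ f T W = begin
    edges f T W                     ≤⟨ ∑-mono T (λ u → ∑-mono W (λ w → 𝟙≤1 (f u w))) ⟩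
    ∑ T (λ _ → ∑ W (λ _ → 1))       ≡⟨ ∑-const T _ ⟩
    length T * ∑ W (λ _ → 1)        ≡⟨ cong (length T *_) (trans (∑-const W 1) (*-identityʳ _)) ⟩
    length T * length W             ∎
    where open ≤-Reasoning

  module _ (p : A → Bool) where

    select : Bool → List A → List A
    select b = filter (λ x → p x Bool.≟ b)

    ∑-select : ∀ l (h : A → ℕ) → ∑ l h ≡ ∑ (select true l) h + ∑ (select false l) h
    ∑-select []      h = refl
    ∑-select (x ∷ l) h with p x
    ... | true  = trans (cong (h x +_) (∑-select l h)) (≡.sym (+-assoc (h x) _ _))
    ... | false = trans (cong (h x +_) (∑-select l h)) (swap (h x) (∑ (select true l) h) _)
      where
      swap : ∀ a b c → a + (b + c) ≡ b + (a + c)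
      swap = solve-∀

    length-select : ∀ l → length l ≡ length (select true l) + length (select false l)
    length-select l = begin
      length l                         ≡⟨ one l ⟨
      ∑ l (λ _ → 1)                    ≡⟨ ∑-select l _ ⟩
      _ ≡⟨ cong₂ _+_ (one (select true l)) (one (select false l)) ⟩
      _ ∎
      where
      open ≡.≡-Reasoning
      one : ∀ (l : List A) → ∑ l (λ _ → 1) ≡ length l
      one l = trans (∑-const l 1) (*-identityʳ _)

    ∑𝟙≡length-select : ∀ l → ∑ l (𝟙 ∘ p) ≡ length (select true l)
    ∑𝟙≡length-select []      = refl
    ∑𝟙≡length-select (x ∷ l) with p x
    ... | true  = cong suc (∑𝟙≡length-select l)
    ... | false = ∑𝟙≡length-select l

    select-∈ : ∀ {b l x} → x ∈ select b l → x ∈ l × p x ≡ b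
    select-∈ {b} = ∈-filter⁻ (λ x → p x Bool.≟ b)

    select-unique : ∀ b {l} → Unique l → Unique (select b l)
    select-unique b = filter⁺ (λ x → p x Bool.≟ b)

  -- Lengths are only bounded below, so that all of the remaining `W` can serve as the right side;
  -- later only the first `s` entries of each side are read.
  record CompletePair (f : A → A → Bool) (s σ : ℕ) (T W : List A) : Set where
    field
      left right   : List A
      left-unique  : Unique left
      right-unique : Unique right
      left-⊆       : ∀ {x} → x ∈ left → x ∈ T
      right-⊆      : ∀ {x} → x ∈ right → x ∈ W
      left-length  : s ≤ length left
      right-length : σ ≤ length right
      complete     : ∀ {x y} → x ∈ left → y ∈ right → f x y ≡ true

  n≤2^n : ∀ n → n ≤ 2 ^ n
  n≤2^n zero    = z≤n
  n≤2^n (suc n) = begin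
    1 + n               ≤⟨ +-mono-≤ (m^n>0 2 n) (n≤2^n n) ⟩
    2 ^ n + 2 ^ n       ≡⟨ cong (2 ^ n +_) (+-identityʳ _) ⟨
    2 ^ suc n           ∎
    where open ≤-Reasoning

  -- Branch on whether the first vertex of T joins the left side: this costs a
  -- factor 2 in the error term and keeps the main term s * |W| additive.
  completePair-or-sparse : ∀ (f : A → A → Bool) s σ T W → Unique T → Unique W →
    CompletePair f s σ T W ⊎ edges f T W ≤ s * length W + 2 ^ length T * σ
  completePair-or-sparse f s σ [] W _ _ = inj₂ z≤n
  completePair-or-sparse f zero σ T@(_ ∷ _) W uT uW with σ ≤? length W
  ... | yes σ≤ = inj₁ record
    { left = [] ; right = W ; left-unique = [] ; right-unique = uW
    ; left-⊆ = λ () ; right-⊆ = λ y → y ; left-length = z≤n ; right-length = σ≤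
    ; complete = λ () }
  -- The left side is already full, but `W` has shrunk below `σ`. All remaining pairs then fit into
  -- the error term, as the length of `T` is at most 2 to that power.
  ... | no  σ≰ = inj₂ (≤-trans (edges≤ f T W)
                         (*-mono-≤ (n≤2^n (length T)) (<⇒≤ (≰⇒> σ≰))))
  completePair-or-sparse f (suc s) σ (u ∷ T) W (u∉T ∷ uT) uW
    with completePair-or-sparse f s σ T (select (f u) true W) uT (select-unique (f u) true uW)
       | completePair-or-sparse f (suc s) σ T (select (f u) false W) uT (select-unique (f u) false uW)
  ... | inj₁ c | _ = inj₁ record
    { left = u ∷ left ; right = right
    ; left-unique = All.tabulate (λ x∈ → All.lookup u∉T (left-⊆ x∈)) ∷ left-unique
    ; right-unique = right-unique
    ; left-⊆ = λ { (here refl) → here refl ; (there x∈) → there (left-⊆ x∈) }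
    ; right-⊆ = λ y∈ → proj₁ (select-∈ (f u) (right-⊆ y∈))
    ; left-length = s≤s left-length ; right-length = right-length
    ; complete = λ { (here refl) y∈ → proj₂ (select-∈ (f u) {l = W} (right-⊆ y∈))
                   ; (there x∈)  y∈ → complete x∈ y∈ } }
    where open CompletePair c
  ... | _ | inj₁ c = inj₁ record
    { left = left ; right = right ; left-unique = left-unique ; right-unique = right-unique
    ; left-⊆ = λ x∈ → there (left-⊆ x∈)
    ; right-⊆ = λ y∈ → proj₁ (select-∈ (f u) (right-⊆ y∈))
    ; left-length = left-length ; right-length = right-length ; complete = complete }
    where open CompletePair c
  -- On the neighbours `W₁` of `u` the coefficient is only `s`, and the `w₁` edges at `u` raise it
  -- to `suc s`, the coefficient on the non-neighbours `W₀`.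
  ... | inj₂ e₁ | inj₂ e₂ = inj₂ (begin
    ∑ W (𝟙 ∘ f u) + edges f T W
      ≡⟨ cong₂ _+_ (∑𝟙≡length-select (f u) W) split ⟩
    w₁ + (edges f T W₁ + edges f T W₀)
      ≤⟨ +-monoʳ-≤ w₁ (+-mono-≤ e₁ e₂) ⟩
    w₁ + ((s * w₁ + 2 ^ length T * σ) + (suc s * w₀ + 2 ^ length T * σ))
      ≡⟨ collect s w₁ w₀ (2 ^ length T) σ ⟩
    suc s * (w₁ + w₀) + 2 ^ suc (length T) * σ
      ≡⟨ cong (λ w → suc s * w + 2 ^ suc (length T) * σ) (length-select (f u) W) ⟨
    suc s * length W + 2 ^ suc (length T) * σ ∎)
    where
    open ≤-Reasoning
    W₁ = select (f u) true W
    W₀ = select (f u) false W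
    w₁ = length W₁
    w₀ = length W₀
    split : edges f T W ≡ edges f T W₁ + edges f T W₀
    split = trans (∑-cong T (λ x → ∑-select (f u) W (λ w → 𝟙 (f x w)))) (∑-distrib-+ T _ _)
    collect : ∀ s x y t σ → x + ((s * x + t * σ) + ((1 + s) * y + t * σ)) ≡
                            (1 + s) * (x + y) + (2 * t) * σ
    collect = solve-∀

  -- With all vertices in `T` the error factor 2^|T| would be useless. Cutting `T` into `k` chunks
  -- of length at most `t` lowers it to 2^t; the price is that the main term occurs `k` times.
  completePair-or-sparse-chunks : ∀ (f : A → A → Bool) s t k T W → Unique T → Unique W →
    length T ≤ k * t →
    CompletePair f s s T W ⊎ edges f T W ≤ k * (s * length W + 2 ^ t * s)
  completePair-or-sparse-chunks f s t zero [] W uT uW _ = inj₂ z≤n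
  completePair-or-sparse-chunks f s t (suc k) T W uT uW |T|≤
    with completePair-or-sparse f s s (take t T) W (take⁺ t uT) uW
       | completePair-or-sparse-chunks f s t k (drop t T) W (drop⁺ t uT) uW
           (subst (_≤ k * t) (≡.sym (length-drop t T)) (m≤n+o⇒m∸n≤o (length T) t |T|≤))
  ... | inj₁ c | _ = inj₁ (widen c (take-∈ t T))
    where
    widen : ∀ {T′} → CompletePair f s s T′ W → (∀ {x} → x ∈ T′ → x ∈ T) → CompletePair f s s T W
    widen c T′⊆ = record { CompletePair c ; left-⊆ = λ x∈ → T′⊆ (CompletePair.left-⊆ c x∈) }
    take-∈ : ∀ t (l : List _) {x} → x ∈ take t l → x ∈ l
    take-∈ (suc t) (_ ∷ l) (here e)  = here e
    take-∈ (suc t) (_ ∷ l) (there i) = there (take-∈ t l i)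
  ... | _ | inj₁ c = inj₁ record { CompletePair c ; left-⊆ = λ x∈ → drop-∈ t T (CompletePair.left-⊆ c x∈) }
    where
    drop-∈ : ∀ t (l : List _) {x} → x ∈ drop t l → x ∈ l
    drop-∈ zero    l       i = i
    drop-∈ (suc t) (_ ∷ l) i = there (drop-∈ t l i)
  ... | inj₂ e₁ | inj₂ e₂ = inj₂ (begin
    edges f T W                                   ≡⟨ cong (λ l → edges f l W) (take++drop≡id t T) ⟨
    edges f (take t T ++ drop t T) W              ≡⟨ ∑-++ (take t T) (drop t T) _ ⟩
    edges f (take t T) W + edges f (drop t T) W   ≤⟨ +-mono-≤ (≤-trans e₁ (+-monoʳ-≤ (s * length W)
                                                      (*-monoˡ-≤ s (^-monoʳ-≤ 2 len≤)))) e₂ ⟩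
    (s * length W + 2 ^ t * s) + k * (s * length W + 2 ^ t * s) ∎)
    where
    open ≤-Reasoning
    len≤ : length (take t T) ≤ t
    len≤ = subst (_≤ t) (≡.sym (length-take t T)) (m⊓n≤m t (length T))

  -- The sides are functions on ℕ, of interest only below `s`, so that parities and neighbouring
  -- indices are plain arithmetic. Disjointness of the sides follows from the absence of loops.
  record Biclique (G : SimpleGraph m) (s : ℕ) : Set where
    field
      a b   : ℕ → Fin m
      a-inj : ∀ {i j} → i < s → j < s → a i ≡ a j → i ≡ j
      b-inj : ∀ {i j} → i < s → j < s → b i ≡ b j → i ≡ j
      a-b   : ∀ {i j} → i < s → j < s → adj G (a i) (b j) ≡ true

  nth : A → List A → ℕ → A
  nth d []      _       = d
  nth d (x ∷ _) zero    = x
  nth d (_ ∷ l) (suc i) = nth d l i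

  nth-∈ : ∀ (d : A) l {i} → i < length l → nth d l i ∈ l
  nth-∈ d (x ∷ l) {zero}  _         = here refl
  nth-∈ d (x ∷ l) {suc i} (s≤s i<l) = there (nth-∈ d l i<l)

  nth-injective : ∀ (d : A) {l} → Unique l → ∀ {i j} → i < length l → j < length l →
                  nth d l i ≡ nth d l j → i ≡ j
  nth-injective d (x∉l ∷ u) {zero}  {zero}  _ _ _ = refl
  nth-injective d {_ ∷ l} (x∉l ∷ u) {zero}  {suc j} _ (s≤s j<) e = ⊥-elim (All.lookup x∉l (nth-∈ d l j<) e)
  nth-injective d {_ ∷ l} (x∉l ∷ u) {suc i} {zero}  (s≤s i<) _ e = ⊥-elim (All.lookup x∉l (nth-∈ d l i<) (≡.sym e))
  nth-injective d (x∉l ∷ u) {suc i} {suc j} (s≤s i<) (s≤s j<) e = cong suc (nth-injective d u i< j< e)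

  completePair⇒biclique : ∀ {G : SimpleGraph m} {s T W} → Fin m → CompletePair (adj G) s s T W → Biclique G s
  completePair⇒biclique d c = record
    { a = nth d left ; b = nth d right
    ; a-inj = λ i< j< → nth-injective d left-unique (<-≤-trans i< left-length) (<-≤-trans j< left-length)
    ; b-inj = λ i< j< → nth-injective d right-unique (<-≤-trans i< right-length) (<-≤-trans j< right-length)
    ; a-b = λ i< j< → complete (nth-∈ d left (<-≤-trans i< left-length))
                               (nth-∈ d right (<-≤-trans j< right-length)) }
    where open CompletePair c

  degreeSum : SimpleGraph m → ℕ
  degreeSum G = ∬ (λ u v → 𝟙 (adj G u v))

  -- With about m/t chunks, `k * t` is at most 2m, and both terms of the bound for one chunk are at
  -- most sm once 2^t ≤ m. So t times the degree sum is at most 4sm², and `t = 8 * s * N` is the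
  -- value that turns this into the claim.
  biclique-or-sparse : ∀ N s .{{_ : NonZero N}} .{{_ : NonZero s}} {m} → 2 ^ (8 * s * N) ≤ m →
                       (G : SimpleGraph m) → Biclique G s ⊎ 2 * N * degreeSum G ≤ m * m
  biclique-or-sparse N s {m} 2^t≤m G = from-pair
    (completePair-or-sparse-chunks (adj G) s t k (allFin m) (allFin m) (allFin⁺ m) (allFin⁺ m) m≤kt)
    where
    t = 8 * s * N
    instance
      t≢0 : NonZero t
      t≢0 = m*n≢0 (8 * s) N {{m*n≢0 8 s}}
      4s≢0 : NonZero (4 * s)
      4s≢0 = m*n≢0 4 s
    k = suc (m / t)
    m≤kt : length (allFin m) ≤ k * t
    m≤kt = begin
      length (allFin m)     ≡⟨ length-allFin m ⟩
      m                     ≡⟨ m≡m%n+[m/n]*n m t ⟩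
      m % t + m / t * t     ≤⟨ +-monoˡ-≤ _ (<⇒≤ (m%n<n m t)) ⟩
      k * t                 ∎
      where open ≤-Reasoning
    from-pair : CompletePair (adj G) s s (allFin m) (allFin m) ⊎
                edges (adj G) (allFin m) (allFin m) ≤ k * (s * length (allFin m) + 2 ^ t * s) →
                Biclique G s ⊎ 2 * N * degreeSum G ≤ m * m
    -- The vertex passed here is the default of `nth`, never returned at an index below `s`; it
    -- exists because 1 ≤ 2^t ≤ m.
    from-pair (inj₁ c) =
      inj₁ (completePair⇒biclique (Fin.fromℕ< (<-≤-trans (m^n>0 2 t) 2^t≤m)) c)
    from-pair (inj₂ e) = inj₂ (*-cancelˡ-≤ (4 * s) (begin
      4 * s * (2 * N * degreeSum G)               ≡⟨ assemble s N (degreeSum G) ⟩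
      t * degreeSum G                             ≤⟨ *-monoʳ-≤ t e ⟩
      t * (k * (s * length (allFin m) + 2 ^ t * s)) ≡⟨ cong (λ l → t * (k * (s * l + 2 ^ t * s))) (length-allFin m) ⟩
      t * (k * (s * m + 2 ^ t * s))               ≡⟨ regroup t k s m (2 ^ t) ⟩
      (t + m / t * t) * (s * (m + 2 ^ t))         ≤⟨ *-mono-≤ (+-mono-≤ (≤-trans (n≤2^n t) 2^t≤m) (m/n*n≤m m t))
                                                      (*-monoʳ-≤ s (+-monoʳ-≤ m 2^t≤m)) ⟩
      (m + m) * (s * (m + m))                     ≡⟨ square m s ⟩
      4 * s * (m * m)                             ∎))
      where
      open ≤-Reasoning
      assemble : ∀ s N d → 4 * s * (2 * N * d) ≡ 8 * s * N * d
      assemble = solve-∀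
      regroup : ∀ t k s m x → t * (k * (s * m + x * s)) ≡ (k * t) * (s * (m + x))
      regroup = solve-∀
      square : ∀ m s → (m + m) * (s * (m + m)) ≡ 4 * s * (m * m)
      square = solve-∀

  -- Cyclic successors in duplicate-free lists

  -- Linear succession, without the step from the last entry to the first: this is what makes it
  -- stable under `_++_` on both sides.
  data Next {A : Set} : List A → A → A → Set where
    now   : ∀ {x y l} → Next (x ∷ y ∷ l) x y
    later : ∀ {x y z l} → Next l x y → Next (z ∷ l) x y

  Next-++ˡ : ∀ {l k : List A} {x y} → Next l x y → Next (l ++ k) x y
  Next-++ˡ now       = now
  Next-++ˡ (later n) = later (Next-++ˡ n)

  Next-++ʳ : ∀ (k : List A) {l x y} → Next l x y → Next (k ++ l) x y
  Next-++ʳ []      n = n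
  Next-++ʳ (_ ∷ k) n = later (Next-++ʳ k n)

  Next-∈ˡ : ∀ {l : List A} {x y} → Next l x y → x ∈ l
  Next-∈ˡ now       = here refl
  Next-∈ˡ (later n) = there (Next-∈ˡ n)

  Next-∈ʳ : ∀ {l : List A} {x y} → Next l x y → y ∈ l
  Next-∈ʳ now       = there (here refl)
  Next-∈ʳ (later n) = there (Next-∈ʳ n)

  Next-≢ : ∀ {l : List A} {x y} → Unique l → Next l x y → x ≢ y
  Next-≢ ((x≢y ∷ _) ∷ _) now       = x≢y
  Next-≢ (_ ∷ u)         (later n) = Next-≢ u n

  data Last {A : Set} : List A → A → Set where
    now   : ∀ {x} → Last (x ∷ []) x
    later : ∀ {x z l} → Last l x → Last (z ∷ l) x

  Last-∈ : ∀ {l : List A} {x} → Last l x → x ∈ l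
  Last-∈ now       = here refl
  Last-∈ (later e) = there (Last-∈ e)

  Next-or-Last : ∀ {l : List A} {x} → x ∈ l → (∃[ y ] Next l x y) ⊎ Last l x
  Next-or-Last {l = _ ∷ []}    (here refl) = inj₂ now
  Next-or-Last {l = _ ∷ _ ∷ _} (here refl) = inj₁ (_ , now)
  Next-or-Last {l = _ ∷ _}     (there x∈) with Next-or-Last x∈
  ... | inj₁ (y , n) = inj₁ (y , later n)
  ... | inj₂ e       = inj₂ (later e)

  headOr : A → List A → A
  headOr h []      = h
  headOr h (x ∷ _) = x

  -- The successor of x in l, where h follows the last entry and entries not in l are fixed.
  successorFrom : Fin m → List (Fin m) → Fin m → Fin m
  successorFrom h []      x = x
  successorFrom h (y ∷ l) x with x ≟ y
  ... | yes _ = headOr h l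
  ... | no  _ = successorFrom h l x

  successor : List (Fin m) → Fin m → Fin m
  successor []      x = x
  successor (h ∷ l) x = successorFrom h (h ∷ l) x

  successorFrom-Next : ∀ h {l : List (Fin m)} {x y} → Unique l → Next l x y → successorFrom h l x ≡ y
  successorFrom-Next h {_ ∷ _ ∷ _} {x} u now with x ≟ x
  ... | yes _  = refl
  ... | no x≢x = ⊥-elim (x≢x refl)
  successorFrom-Next h {z ∷ _ ∷ _} {x} (z∉ ∷ u) (later n) with x ≟ z
  ... | yes refl = ⊥-elim (All.lookup z∉ (Next-∈ˡ n) refl)
  ... | no _     = successorFrom-Next h u n

  successorFrom-Last : ∀ h {l : List (Fin m)} {x} → Unique l → Last l x → successorFrom h l x ≡ h
  successorFrom-Last h {x ∷ []} u now with x ≟ x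
  ... | yes _  = refl
  ... | no x≢x = ⊥-elim (x≢x refl)
  successorFrom-Last h {z ∷ _ ∷ _} {x} (z∉ ∷ u) (later e) with x ≟ z
  ... | yes refl = ⊥-elim (All.lookup z∉ (Last-∈ e) refl)
  ... | no _     = successorFrom-Last h u e

  successor-Next : ∀ {l : List (Fin m)} {x y} → Unique l → Next l x y → successor l x ≡ y
  successor-Next {l = h ∷ _} = successorFrom-Next h

  successor-Last : ∀ {h} {l : List (Fin m)} {x} → Unique (h ∷ l) → Last (h ∷ l) x → successor (h ∷ l) x ≡ h
  successor-Last {h = h} = successorFrom-Last h

  successor-∈ : ∀ {l : List (Fin m)} {x} → Unique l → x ∈ l → successor l x ∈ l
  successor-∈ {l = h ∷ l} {x} u x∈ with Next-or-Last x∈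
  ... | inj₁ (y , n) = subst (_∈ h ∷ l) (≡.sym (successor-Next u n)) (Next-∈ʳ n)
  ... | inj₂ e       = subst (_∈ h ∷ l) (≡.sym (successor-Last u e)) (here refl)

  Next-injective : ∀ {l : List A} {x x′ y} → Unique l → Next l x y → Next l x′ y → x ≡ x′
  Next-injective u now now = refl
  Next-injective ((_ ∷ _) ∷ y∉ ∷ _) now (later (later n)) = ⊥-elim (All.lookup y∉ (Next-∈ʳ n) refl)
  Next-injective ((_ ∷ _) ∷ y∉ ∷ _) now (later now) = ⊥-elim (All.lookup y∉ (here refl) refl)
  Next-injective ((_ ∷ _) ∷ y∉ ∷ _) (later (later n)) now = ⊥-elim (All.lookup y∉ (Next-∈ʳ n) refl)
  Next-injective ((_ ∷ _) ∷ y∉ ∷ _) (later now) now = ⊥-elim (All.lookup y∉ (here refl) refl)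
  Next-injective (_ ∷ u) (later n) (later n′) = Next-injective u n n′

  Last-unique : ∀ {l : List A} {x x′} → Last l x → Last l x′ → x ≡ x′
  Last-unique now now = refl
  Last-unique (later e) (later e′) = Last-unique e e′

  Next-≢head : ∀ {h} {l : List A} {x y} → Unique (h ∷ l) → Next (h ∷ l) x y → y ≢ h
  Next-≢head (h∉ ∷ _) now       refl = All.lookup h∉ (here refl) refl
  Next-≢head (h∉ ∷ _) (later n) refl = All.lookup h∉ (Next-∈ʳ n) refl

  successor-injective : ∀ {l : List (Fin m)} {x y} → Unique l → x ∈ l → y ∈ l →
                        successor l x ≡ successor l y → x ≡ y
  successor-injective {l = h ∷ l} u x∈ y∈ e with Next-or-Last x∈ | Next-or-Last y∈
  ... | inj₁ (x′ , n) | inj₁ (y′ , n′) = Next-injective u n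
          (subst (Next (h ∷ l) _) (trans (≡.sym (successor-Next u n′)) (trans (≡.sym e) (successor-Next u n))) n′)
  ... | inj₁ (x′ , n) | inj₂ z = ⊥-elim (Next-≢head u n
          (trans (≡.sym (successor-Next u n)) (trans e (successor-Last u z))))
  ... | inj₂ z | inj₁ (y′ , n) = ⊥-elim (Next-≢head u n
          (trans (≡.sym (successor-Next u n)) (trans (≡.sym e) (successor-Last u z))))
  ... | inj₂ z | inj₂ z′ = Last-unique z z′

  iterate-+ : ∀ (f : A → A) j k x → iterate f (j + k) x ≡ iterate f j (iterate f k x)
  iterate-+ f zero    k x = refl
  iterate-+ f (suc j) k x = cong f (iterate-+ f j k x)

  module _ {f : A → A} where

    reaches-trans : ∀ {x y z} → ∃[ k ] iterate f k x ≡ y → ∃[ k ] iterate f k y ≡ z → ∃[ k ] iterate f k x ≡ z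
    reaches-trans {x} (j , refl) (k , refl) = k + j , iterate-+ f k j x

    head-reaches : ∀ {h l w} → (∀ {x y} → Next (h ∷ l) x y → f x ≡ y) → w ∈ h ∷ l → ∃[ k ] iterate f k h ≡ w
    head-reaches nx (here refl) = 0 , refl
    head-reaches {l = _ ∷ _} nx (there w∈) =
      reaches-trans (1 , nx now) (head-reaches (nx ∘ later) w∈)

    reaches-last : ∀ {h l w} → (∀ {x y} → Next l x y → f x ≡ y) → (∀ {x} → Last l x → f x ≡ h) →
                   w ∈ l → ∃[ k ] iterate f k w ≡ h
    reaches-last {l = _ ∷ []}    nx ls (here refl) = 1 , ls now
    reaches-last {l = _ ∷ _ ∷ _} nx ls (here refl) =
      reaches-trans (1 , nx now) (reaches-last (nx ∘ later) (ls ∘ later) (here refl))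
    reaches-last {l = _ ∷ _ ∷ _} nx ls (there w∈)  = reaches-last (nx ∘ later) (ls ∘ later) w∈

  -- From `x` run to the last entry, wrap around to the head, then run forward to `y`.
  successor-cyclic : ∀ {l : List (Fin m)} {x y} → Unique l → x ∈ l → y ∈ l →
                     ∃[ k ] iterate (successor l) k x ≡ y
  successor-cyclic {l = _ ∷ _} u x∈ y∈ =
    reaches-trans (reaches-last (successor-Next u) (successor-Last u) x∈)
                  (head-reaches (successor-Next u) y∈)

  -- Rotation systems from neighbour lists

  record Enumeration (G : SimpleGraph m) : Set where
    field
      nbrs     : Fin m → List (Fin m)
      unique   : ∀ u → Unique (nbrs u)
      sound    : ∀ {u v} → v ∈ nbrs u → adj G u v ≡ true
      complete : ∀ {u v} → adj G u v ≡ true → v ∈ nbrs u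

  -- Four consecutive corners of a facial walk through the dart (u , v), none of
  -- which uses the step from the last to the first entry of a neighbour list.
  Quad : (Fin m → List (Fin m)) → Fin m → Fin m → Set
  Quad L u v = ∃[ c ] ∃[ e ] Next (L v) u c × Next (L c) v e × Next (L e) c u × Next (L u) e v

  module _ {G : SimpleGraph m} (E : Enumeration G) where
    open Enumeration E

    rotation : Rotation G
    rotation = record
      { next     = λ u → successor (nbrs u)
      ; next-adj = λ u v e → sound (successor-∈ (unique u) (complete e))
      ; next-inj = λ u v w ev ew → successor-injective (unique u) (complete ev) (complete ew)
      ; next-cyc = λ u v w ev ew → successor-cyclic (unique u) (complete ev) (complete ew)
      }

    adj⇒≢ : ∀ {u v} → adj G u v ≡ true → u ≢ v
    adj⇒≢ {u} e refl with () ← trans (≡.sym e) (irrefl G u)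

    -- The four `Next` steps are exactly the four face steps, so the walk closes. Consecutive
    -- corners differ because they are adjacent, opposite corners because they are consecutive in a
    -- list without repetitions.
    Quad⇒onQuadFace : ∀ {u v} → Quad nbrs u v → onQuadFace rotation (u , v) ≡ true
    Quad⇒onQuadFace {u} {v} (c , e , n₁ , n₂ , n₃ , n₄)
      rewrite successor-Next (unique v) n₁ | successor-Next (unique c) n₂
            | successor-Next (unique e) n₃ | successor-Next (unique u) n₄ = corners
      where
      u≢v : u ≢ v
      u≢v = adj⇒≢ (sound (Next-∈ʳ n₄))
      v≢c : v ≢ c
      v≢c = adj⇒≢ (sound (Next-∈ʳ n₁))
      c≢e : c ≢ e
      c≢e = adj⇒≢ (sound (Next-∈ʳ n₂))
      e≢u : e ≢ u
      e≢u = adj⇒≢ (sound (Next-∈ʳ n₃))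
      corners : ((u , v) ≡ᵇ (u , v)) ∧ (u ≠ᵇ v) ∧ (u ≠ᵇ c) ∧ (u ≠ᵇ e) ∧ (v ≠ᵇ c) ∧ (v ≠ᵇ e) ∧ (c ≠ᵇ e) ≡ true
      corners with u ≟ u | v ≟ v | u ≟ v | u ≟ c | u ≟ e | v ≟ c | v ≟ e | c ≟ e
      ... | no ¬p | _ | _ | _ | _ | _ | _ | _ = ⊥-elim (¬p refl)
      ... | _ | no ¬p | _ | _ | _ | _ | _ | _ = ⊥-elim (¬p refl)
      ... | _ | _ | yes p | _ | _ | _ | _ | _ = ⊥-elim (u≢v p)
      ... | _ | _ | _ | yes p | _ | _ | _ | _ = ⊥-elim (Next-≢ (unique v) n₁ p)
      ... | _ | _ | _ | _ | yes p | _ | _ | _ = ⊥-elim (e≢u (≡.sym p))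
      ... | _ | _ | _ | _ | _ | yes p | _ | _ = ⊥-elim (v≢c p)
      ... | _ | _ | _ | _ | _ | _ | yes p | _ = ⊥-elim (Next-≢ (unique c) n₂ p)
      ... | _ | _ | _ | _ | _ | _ | _ | yes p = ⊥-elim (c≢e p)
      ... | yes _ | yes _ | no _ | no _ | no _ | no _ | no _ | no _ = refl

  -- Alternating rotations on a complete bipartite graph

  block : Bool → (ℕ → A) → ℕ → List A
  block true  = applyUpTo
  block false = applyDownFrom

  block-∈⁺ : ∀ d (f : ℕ → A) {s i} → i < s → f i ∈ block d f s
  block-∈⁺ true  f = ∈-applyUpTo⁺ f
  block-∈⁺ false f = ∈-applyDownFrom⁺ f

  block-∈⁻ : ∀ d (f : ℕ → A) {s v} → v ∈ block d f s → ∃[ i ] i < s × f i ≡ v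
  block-∈⁻ true  f v∈ with i , i<s , e ← ∈-applyUpTo⁻ f v∈ = i , i<s , ≡.sym e
  block-∈⁻ false f v∈ with i , i<s , e ← ∈-applyDownFrom⁻ f v∈ = i , i<s , ≡.sym e

  InjectiveBelow : ℕ → (ℕ → A) → Set
  InjectiveBelow s f = ∀ {i j} → i < s → j < s → f i ≡ f j → i ≡ j

  block-unique : ∀ d (f : ℕ → A) s → InjectiveBelow s f → Unique (block d f s)
  block-unique true  f s inj = applyUpTo⁺₁ f s (λ i<j j<s e → <⇒≢ i<j (inj (<-trans i<j j<s) j<s e))
  block-unique false f s inj = applyDownFrom⁺₁ f s (λ j<i i<s e → <⇒≢ j<i (inj (<-trans j<i i<s) i<s (≡.sym e)))

  Next-applyUpTo : ∀ (f : ℕ → A) {s k} → suc k < s → Next (applyUpTo f s) (f k) (f (suc k))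
  Next-applyUpTo f {k = zero}  (s≤s (s≤s _)) = now
  Next-applyUpTo f {k = suc k} (s≤s 1+k<s)   = later (Next-applyUpTo (f ∘ suc) 1+k<s)

  Next-applyDownFrom : ∀ (f : ℕ → A) {s k} → suc k < s → Next (applyDownFrom f s) (f (suc k)) (f k)
  Next-applyDownFrom f {suc s} {k} (s≤s 1+k≤s) with m≤n⇒m<n∨m≡n 1+k≤s
  ... | inj₁ 1+k<s = later (Next-applyDownFrom f 1+k<s)
  ... | inj₂ refl  = now

  even : ℕ → Bool
  even zero    = true
  even (suc n) = not (even n)

  step : Bool → ℕ → ℕ
  step true  = suc
  step false = pred

  step-< : ∀ {s k} → suc k < s → ∀ d → step d k < s
  step-< 1+k<s true  = 1+k<s
  step-< {k = k} 1+k<s false = ≤-<-trans (≤-trans pred[n]≤n (n≤1+n k)) 1+k<s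

  even-step : ∀ {k} → 0 < k → ∀ d → even (step d k) ≡ not (even k)
  even-step _ true = refl
  even-step {suc k} _ false = ≡.sym (not-involutive (even k))

  Next-step : ∀ (f : ℕ → A) {s k} → 0 < k → suc k < s → ∀ d → Next (block d f s) (f k) (f (step d k))
  Next-step f _ 1+k<s true = Next-applyUpTo f 1+k<s
  Next-step f {k = suc k} _ 2+k<s false = Next-applyDownFrom f (<-trans ≤-refl 2+k<s)

  -- Reversing the block reverses its steps; this gives the way back on the far side of a
  -- quadrangle.
  Next-step⁻ : ∀ (f : ℕ → A) {s k} → 0 < k → suc k < s → ∀ d → Next (block (not d) f s) (f (step d k)) (f k)
  Next-step⁻ f _ 1+k<s true = Next-applyDownFrom f 1+k<s
  Next-step⁻ f {k = suc k} _ 2+k<s false = Next-applyUpTo f (<-trans ≤-refl 2+k<s)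

  -- The facial walk through (a i , b j) visits a i, b j, a (i ± 1), b (j ± 1): the
  -- orientations alternate with the parity of the index, so the steps cancel in pairs.
  block-Quad : ∀ {s} (L : Fin m → List (Fin m)) (a b : ℕ → Fin m) →
    (∀ {i x y} → i < s → Next (block (even i) b s) x y → Next (L (a i)) x y) →
    (∀ {j x y} → j < s → Next (block (even j) a s) x y → Next (L (b j)) x y) →
    ∀ {i j} → 0 < i → suc i < s → 0 < j → suc j < s → Quad L (a i) (b j)
  block-Quad {s = s} L a b La Lb {i} {j} 0<i 1+i<s 0<j 1+j<s =
    a i′ , b j′
    , Lb (<-trans ≤-refl 1+j<s) (Next-step a 0<i 1+i<s (even j))
    , La (step-< 1+i<s (even j))
        (subst (λ d → Next (block d b s) (b j) (b j′)) (≡.sym (even-step 0<i (even j)))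
          (Next-step b 0<j 1+j<s (not (even i))))
    , Lb (step-< 1+j<s (not (even i)))
        (subst (λ d → Next (block d a s) (a i′) (a i)) (≡.sym (even-step 0<j (not (even i))))
          (Next-step⁻ a 0<i 1+i<s (even j)))
    , La (<-trans ≤-refl 1+i<s)
        (subst (λ d → Next (block d b s) (b j′) (b j)) (not-involutive (even i))
          (Next-step⁻ b 0<j 1+j<s (not (even i))))
    where
    i′ = step (even j) i
    -- The walk changes `j` at `a i′`, not at `a i`, and `i′` has the opposite parity; hence the
    -- `not`.
    j′ = step (not (even i)) j

  -- Counting the border of a copy

  Within : ℕ → (ℕ → A) → A → Set
  Within s f u = ∃[ i ] i < s × f i ≡ u

  within? : ∀ s (f : ℕ → Fin m) u → Dec (Within s f u)
  within? s f u = anyUpTo? (λ i → f i ≟ u) s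

  -- A count of preimages instead of the indicator of `Within`: its sum over all vertices is `s` for
  -- every `f`, and injectivity enters only when it is compared with the indicator.
  multiplicity : ℕ → (ℕ → Fin m) → Fin m → ℕ
  multiplicity zero    f u = 0
  multiplicity (suc s) f u = 𝟙 (does (f s ≟ u)) + multiplicity s f u

  ∑-multiplicity : ∀ s (f : ℕ → Fin m) → ∑ (allFin m) (multiplicity s f) ≡ s
  ∑-multiplicity {m} zero    f = ∑-0 (allFin m)
  ∑-multiplicity {m} (suc s) f =
    trans (∑-distrib-+ (allFin m) _ _) (cong₂ _+_ (∑-point (f s)) (∑-multiplicity s f))

  𝟙-does≥1 : {P : Set} (p? : Dec P) → P → 1 ≤ 𝟙 (does p?)
  𝟙-does≥1 p? p = ≤-reflexive (cong 𝟙 (≡.sym (dec-true p? p)))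

  multiplicity≥1 : ∀ s (f : ℕ → Fin m) {u} → Within s f u → 1 ≤ multiplicity s f u
  multiplicity≥1 (suc s) f {u} (i , i<1+s , fi≡u) with m≤n⇒m<n∨m≡n i<1+s
  ... | inj₁ (s≤s i<s) = ≤-trans (multiplicity≥1 s f (i , i<s , fi≡u)) (m≤n+m _ _)
  ... | inj₂ refl      = ≤-trans (𝟙-does≥1 (f s ≟ u) fi≡u) (m≤m+n _ _)

  multiplicity≡0 : ∀ s (f : ℕ → Fin m) {u} → ¬ Within s f u → multiplicity s f u ≡ 0
  multiplicity≡0 zero    f ∉ = refl
  multiplicity≡0 (suc s) f {u} ∉ with f s ≟ u
  ... | yes e = ⊥-elim (∉ (s , ≤-refl , e))
  ... | no _  = multiplicity≡0 s f (λ { (i , i<s , e) → ∉ (i , m≤n⇒m≤1+n i<s , e) })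

  multiplicity≤1 : ∀ s (f : ℕ → Fin m) u → InjectiveBelow s f → multiplicity s f u ≤ 1
  multiplicity≤1 zero    f u inj = z≤n
  multiplicity≤1 (suc s) f u inj with f s ≟ u
  ... | no _  = multiplicity≤1 s f u (λ i< j< → inj (m≤n⇒m≤1+n i<) (m≤n⇒m≤1+n j<))
  ... | yes e = s≤s (≤-reflexive (multiplicity≡0 s f
                  (λ { (i , i<s , e′) → <⇒≢ i<s (inj (m≤n⇒m≤1+n i<s) ≤-refl (trans e′ (≡.sym e))) })))

  multiplicity≤𝟙 : ∀ s (f : ℕ → Fin m) u → InjectiveBelow s f →
                   multiplicity s f u ≤ 𝟙 (does (within? s f u))
  multiplicity≤𝟙 s f u inj with within? s f u
  ... | yes _ = multiplicity≤1 s f u inj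
  ... | no ∉  = ≤-reflexive (multiplicity≡0 s f ∉)

  -- Counted with multiplicity, so that the sum is 2 even if the two end vertices coincide, as for
  -- `s = 1`.
  ends : ℕ → (ℕ → Fin m) → Fin m → ℕ
  ends s f u = 𝟙 (does (f 0 ≟ u)) + 𝟙 (does (f (pred s) ≟ u))

  ∑-ends : ∀ s (f : ℕ → Fin m) → ∑ (allFin m) (ends s f) ≡ 2
  ∑-ends {m} s f = trans (∑-distrib-+ (allFin m) _ _) (cong₂ _+_ (∑-point (f 0)) (∑-point (f (pred s))))

  interior-or-end : ∀ s (f : ℕ → Fin m) {i} → i < s → (0 < i × suc i < s) ⊎ 1 ≤ ends s f (f i)
  interior-or-end s f {zero}  i<s = inj₂ (≤-trans (𝟙-does≥1 (f 0 ≟ f 0) refl) (m≤m+n _ _))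
  interior-or-end s f {suc i} i<s with m≤n⇒m<n∨m≡n i<s
  ... | inj₁ lt   = inj₁ (s≤s z≤n , lt)
  ... | inj₂ refl = inj₂ (≤-trans (𝟙-does≥1 (f (suc i) ≟ f (suc i)) refl) (m≤n+m _ _))

  -- Sums of products make the double sum factor. Corner pairs are counted twice, which is harmless
  -- in an upper bound.
  borderPairs : ℕ → (f g : ℕ → Fin m) → Fin m → Fin m → ℕ
  borderPairs s f g u v = ends s f u * multiplicity s g v + multiplicity s f u * ends s g v

  ∬-borderPairs : ∀ s (f g : ℕ → Fin m) → ∬ (borderPairs s f g) ≡ 4 * s
  ∬-borderPairs {m} s f g = begin
    ∬ (borderPairs s f g) ≡⟨ ∬-distrib-+ {m} _ _ ⟩
    _ ≡⟨ cong₂ _+_ (∬-product (ends s f) (multiplicity s g)) (∬-product (multiplicity s f) (ends s g)) ⟩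
    _ ≡⟨ cong₂ _+_ (cong₂ _*_ (∑-ends s f) (∑-multiplicity s g)) (cong₂ _*_ (∑-multiplicity s f) (∑-ends s g)) ⟩
    2 * s + s * 2 ≡⟨ total s ⟩
    4 * s ∎
    where
    open ≡.≡-Reasoning
    total : ∀ s → 2 * s + s * 2 ≡ 4 * s
    total = solve-∀

  interior-or-border : ∀ s (f g : ℕ → Fin m) {i j} → i < s → j < s →
    ((0 < i × suc i < s) × (0 < j × suc j < s)) ⊎ 1 ≤ borderPairs s f g (f i) (g j)
  interior-or-border s f g {i} {j} i<s j<s with interior-or-end s f i<s | interior-or-end s g j<s
  ... | inj₁ p | inj₁ q = inj₁ (p , q)
  ... | inj₂ e | _      = inj₂ (m≤n⇒m≤n+o _ (*-mono-≤ e (multiplicity≥1 s g (j , j<s , refl))))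
  ... | inj₁ _ | inj₂ e = inj₂ (m≤n⇒m≤o+n (ends s f (f i) * _) (*-mono-≤ (multiplicity≥1 s f (i , i<s , refl)) e))

  -- defect bounds from above the number of darts whose edge need not lie on two quadrangles.
  record Drawing (G : SimpleGraph m) : Set where
    field
      enumeration : Enumeration G
    open Enumeration enumeration public
    field
      defect  : Fin m → Fin m → ℕ
      quads   : ∀ {u v} → adj G u v ≡ true → (Quad nbrs u v × Quad nbrs v u) ⊎ 1 ≤ defect u v

  -- Ends the recursion at a sparse graph: the neighbours come in any order and every edge is
  -- written off as defective.
  trivialDrawing : (G : SimpleGraph m) → Drawing G
  trivialDrawing {m} G = record
    { enumeration = record
      { nbrs     = λ u → filter (λ v → adj G u v Bool.≟ true) (allFin m)
      ; unique   = λ u → filter⁺ (λ v → adj G u v Bool.≟ true) (allFin⁺ m)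
      ; sound    = λ {u} v∈ → proj₂ (∈-filter⁻ (λ v → adj G u v Bool.≟ true) {xs = allFin m} v∈)
      ; complete = λ {u} {v} e → ∈-filter⁺ (λ v → adj G u v Bool.≟ true) (∈-allFin v) e
      }
    ; defect = λ u v → 𝟙 (adj G u v)
    ; quads  = λ e → inj₂ (≤-reflexive (cong 𝟙 (≡.sym e)))
    }

  -- Taking out a copy of K_{s,s} and putting it back

  module BicliqueRemoval {G : SimpleGraph m} {s : ℕ} (K : Biclique G s) where
    open Biclique K

    InK : Fin m → Fin m → Set
    InK u v = (Within s a u × Within s b v) ⊎ (Within s b u × Within s a v)

    inK? : ∀ u v → Dec (InK u v)
    inK? u v = (within? s a u ×-dec within? s b v) ⊎-dec (within? s b u ×-dec within? s a v)

    InK⇒adj : ∀ {u v} → InK u v → adj G u v ≡ true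
    InK⇒adj (inj₁ ((i , i<s , refl) , (j , j<s , refl))) = a-b i<s j<s
    InK⇒adj (inj₂ ((j , j<s , refl) , (i , i<s , refl))) = trans (sym G _ _) (a-b i<s j<s)

    -- A vertex on both sides would be adjacent to itself.
    disjoint : ∀ {u} → Within s a u → Within s b u → ⊥
    disjoint {u} u∈a u∈b with () ← trans (≡.sym (InK⇒adj (inj₁ (u∈a , u∈b)))) (irrefl G u)

    rest : SimpleGraph m
    rest = record
      { adj    = λ u v → adj G u v ∧ not (does (inK? u v))
      ; sym    = λ u v → cong₂ (λ p q → p ∧ not q) (sym G u v)
                   (trans (∨-comm (does (within? s a u) ∧ does (within? s b v)) _)
                     (cong₂ _∨_ (∧-comm (does (within? s b u)) _) (∧-comm (does (within? s a u)) _)))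
      ; irrefl = λ u → cong (_∧ not (does (inK? u u))) (irrefl G u)
      }

    adj-cases : ∀ {u v} → adj G u v ≡ true → InK u v ⊎ adj rest u v ≡ true
    adj-cases {u} {v} e with inK? u v
    ... | yes k = inj₁ k
    ... | no ¬k = inj₂ (cong₂ (λ p q → p ∧ not q) e (dec-false (inK? u v) ¬k))

    rest⇒adj : ∀ {u v} → adj rest u v ≡ true → adj G u v ≡ true
    rest⇒adj {u} {v} e with adj G u v
    ... | true = refl

    rest⇒¬InK : ∀ {u v} → adj rest u v ≡ true → ¬ InK u v
    rest⇒¬InK {u} {v} e k with () ← trans (≡.sym e)
      (cong₂ (λ p q → p ∧ not q) (InK⇒adj k) (dec-true (inK? u v) k))

    -- The orientation depends on the index that `within?` happens to find; injectivity makes it the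
    -- only one, and disjointness makes the order of the two tests immaterial.
    prefix : Fin m → List (Fin m)
    prefix u with within? s a u | within? s b u
    ... | yes (i , _) | _           = block (even i) b s
    ... | no _        | yes (j , _) = block (even j) a s
    ... | no _        | no _        = []

    prefix-a : ∀ {i} → i < s → prefix (a i) ≡ block (even i) b s
    prefix-a {i} i<s with within? s a (a i) | within? s b (a i)
    ... | yes (i′ , i′<s , e) | _ = cong (λ k → block (even k) b s) (a-inj i′<s i<s e)
    ... | no ∉ | _ = ⊥-elim (∉ (i , i<s , refl))

    prefix-b : ∀ {j} → j < s → prefix (b j) ≡ block (even j) a s
    prefix-b {j} j<s with within? s a (b j) | within? s b (b j)
    ... | yes p | _ = ⊥-elim (disjoint p (j , j<s , refl))
    ... | no _ | yes (j′ , j′<s , e) = cong (λ k → block (even k) a s) (b-inj j′<s j<s e)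
    ... | no _ | no ∉ = ⊥-elim (∉ (j , j<s , refl))

    prefix-∈⁺ : ∀ {u v} → InK u v → v ∈ prefix u
    prefix-∈⁺ (inj₁ ((i , i<s , refl) , (j , j<s , refl))) =
      subst (b j ∈_) (≡.sym (prefix-a i<s)) (block-∈⁺ (even i) b j<s)
    prefix-∈⁺ (inj₂ ((j , j<s , refl) , (i , i<s , refl))) =
      subst (a i ∈_) (≡.sym (prefix-b j<s)) (block-∈⁺ (even j) a i<s)

    prefix-∈⁻ : ∀ {u v} → v ∈ prefix u → InK u v
    prefix-∈⁻ {u} v∈ with within? s a u | within? s b u
    ... | yes p@(i , _) | _             = inj₁ (p , block-∈⁻ (even i) b v∈)
    ... | no _          | yes p@(j , _) = inj₂ (p , block-∈⁻ (even j) a v∈)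

    prefix-unique : ∀ u → Unique (prefix u)
    prefix-unique u with within? s a u | within? s b u
    ... | yes (i , _) | _           = block-unique (even i) b s b-inj
    ... | no _        | yes (j , _) = block-unique (even j) a s a-inj
    ... | no _        | no _        = []

    newDefect : Fin m → Fin m → ℕ
    newDefect u v = borderPairs s a b u v + borderPairs s b a u v

    ∬-newDefect : ∬ newDefect ≡ 8 * s
    ∬-newDefect = begin
      ∬ newDefect    ≡⟨ ∬-distrib-+ {m} _ _ ⟩
      _              ≡⟨ cong₂ _+_ (∬-borderPairs s a b) (∬-borderPairs s b a) ⟩
      4 * s + 4 * s  ≡⟨ *-distribʳ-+ s 4 4 ⟨
      8 * s          ∎
      where open ≡.≡-Reasoning

    -- Each orientation of the removed edges is counted by a product of multiplicities, with sum s².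
    -- Injectivity on each side and disjointness of the sides keep the two products together below
    -- the indicator of `InK`.
    degreeSum-rest : degreeSum rest + 2 * (s * s) ≤ degreeSum G
    degreeSum-rest = begin
      degreeSum rest + 2 * (s * s)
        ≡⟨ cong (degreeSum rest +_) (trans (double s) (≡.sym sums)) ⟩
      degreeSum rest + ∬ pairs
        ≡⟨ ∬-distrib-+ {m} _ _ ⟨
      ∬ (λ u v → 𝟙 (adj rest u v) + pairs u v)
        ≤⟨ ∬-mono {m} pointwise ⟩
      degreeSum G ∎
      where
      open ≤-Reasoning
      pairs : Fin m → Fin m → ℕ
      pairs u v = multiplicity s a u * multiplicity s b v + multiplicity s b u * multiplicity s a v
      double : ∀ s → 2 * (s * s) ≡ s * s + s * s
      double = solve-∀
      mult-mult : ∀ f g → ∬ (λ u v → multiplicity s f u * multiplicity s g v) ≡ s * s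
      mult-mult f g = trans (∬-product (multiplicity s f) (multiplicity s g))
                            (cong₂ _*_ (∑-multiplicity s f) (∑-multiplicity s g))
      sums : ∬ pairs ≡ s * s + s * s
      sums = trans (∬-distrib-+ {m} _ _) (cong₂ _+_ (mult-mult a b) (mult-mult b a))
      exclusive : ∀ {P R : Set} (p? : Dec P) q (r? : Dec R) t → (P → R → ⊥) →
        𝟙 (does p?) * 𝟙 q + 𝟙 (does r?) * 𝟙 t ≤ 𝟙 ((does p? ∧ q) ∨ (does r? ∧ t))
      exclusive (yes p) q     (yes r) t     ¬pr = ⊥-elim (¬pr p r)
      exclusive (yes _) false (no _)  t     _   = z≤n
      exclusive (yes _) true  (no _)  t     _   = ≤-refl
      exclusive (no _)  q     (yes _) false _   = z≤n
      exclusive (no _)  q     (yes _) true  _   = ≤-refl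
      exclusive (no _)  q     (no _)  t     _   = z≤n
      pairs≤ : ∀ u v → pairs u v ≤ 𝟙 (does (inK? u v))
      pairs≤ u v = ≤-trans
        (+-mono-≤ (*-mono-≤ (multiplicity≤𝟙 s a u a-inj) (multiplicity≤𝟙 s b v b-inj))
                  (*-mono-≤ (multiplicity≤𝟙 s b u b-inj) (multiplicity≤𝟙 s a v a-inj)))
        (exclusive (within? s a u) _ (within? s b u) _ disjoint)
      split : ∀ u v → 𝟙 (adj rest u v) + 𝟙 (does (inK? u v)) ≤ 𝟙 (adj G u v)
      split u v with inK? u v
      ... | yes k = ≤-reflexive (trans
            (cong₂ (λ p q → 𝟙 (p ∧ not q) + 𝟙 q) (InK⇒adj k) (dec-true (inK? u v) k))
            (cong 𝟙 (≡.sym (InK⇒adj k))))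
      ... | no ¬k = ≤-reflexive (trans
            (cong (λ q → 𝟙 (adj G u v ∧ not q) + 𝟙 q) (dec-false (inK? u v) ¬k))
            (trans (+-identityʳ _) (cong 𝟙 (∧-identityʳ (adj G u v)))))
      pointwise : ∀ u v → 𝟙 (adj rest u v) + pairs u v ≤ 𝟙 (adj G u v)
      pointwise u v = ≤-trans (+-monoʳ-≤ (𝟙 (adj rest u v)) (pairs≤ u v)) (split u v)

    module _ (D : Drawing rest) where
      private module D = Drawing D

      nbrs⁺ : Fin m → List (Fin m)
      nbrs⁺ u = prefix u ++ D.nbrs u

      -- Prepending blocks leaves consecutive entries consecutive, so quadrangles found for `rest`
      -- survive whatever is placed before them.
      Quad⁺ : ∀ {u v} → Quad D.nbrs u v → Quad nbrs⁺ u v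
      Quad⁺ (c , e , n₁ , n₂ , n₃ , n₄) =
        c , e , Next-++ʳ (prefix _) n₁ , Next-++ʳ (prefix _) n₂ , Next-++ʳ (prefix _) n₃ , Next-++ʳ (prefix _) n₄

      Next-a : ∀ {i x y} → i < s → Next (block (even i) b s) x y → Next (nbrs⁺ (a i)) x y
      Next-a i<s n = Next-++ˡ (subst (λ l → Next l _ _) (≡.sym (prefix-a i<s)) n)

      Next-b : ∀ {j x y} → j < s → Next (block (even j) a s) x y → Next (nbrs⁺ (b j)) x y
      Next-b j<s n = Next-++ˡ (subst (λ l → Next l _ _) (≡.sym (prefix-b j<s)) n)

      quads-InK : ∀ {u v} → InK u v → (Quad nbrs⁺ u v × Quad nbrs⁺ v u) ⊎ 1 ≤ newDefect u v
      quads-InK (inj₁ ((i , i<s , refl) , (j , j<s , refl))) with interior-or-border s a b i<s j<s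
      ... | inj₁ ((p , q) , (r , t)) = inj₁ (block-Quad nbrs⁺ a b Next-a Next-b p q r t
                                            , block-Quad nbrs⁺ b a Next-b Next-a r t p q)
      ... | inj₂ e = inj₂ (m≤n⇒m≤n+o _ e)
      quads-InK (inj₂ ((j , j<s , refl) , (i , i<s , refl))) with interior-or-border s b a j<s i<s
      ... | inj₁ ((r , t) , (p , q)) = inj₁ (block-Quad nbrs⁺ b a Next-b Next-a r t p q
                                            , block-Quad nbrs⁺ a b Next-a Next-b p q r t)
      ... | inj₂ e = inj₂ (m≤n⇒m≤o+n (borderPairs s a b (b j) (a i)) e)

      extend : Drawing G
      extend = record
        { enumeration = record
          { nbrs     = nbrs⁺
          ; unique   = λ u → ++⁺ (prefix-unique u) (D.unique u)
                         (λ (v∈ , v∈′) → rest⇒¬InK (D.sound v∈′) (prefix-∈⁻ v∈))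
          ; sound    = sound⁺
          ; complete = complete⁺
          }
        ; defect = λ u v → D.defect u v + newDefect u v
        ; quads  = quads⁺
        }
        where
        sound⁺ : ∀ {u v} → v ∈ nbrs⁺ u → adj G u v ≡ true
        sound⁺ {u} v∈ with ∈-++⁻ (prefix u) v∈
        ... | inj₁ p = InK⇒adj (prefix-∈⁻ p)
        ... | inj₂ p = rest⇒adj (D.sound p)
        complete⁺ : ∀ {u v} → adj G u v ≡ true → v ∈ nbrs⁺ u
        complete⁺ {u} e with adj-cases e
        ... | inj₁ k = ∈-++⁺ˡ (prefix-∈⁺ k)
        ... | inj₂ r = ∈-++⁺ʳ (prefix u) (D.complete r)
        quads⁺ : ∀ {u v} → adj G u v ≡ true →
                 (Quad nbrs⁺ u v × Quad nbrs⁺ v u) ⊎ 1 ≤ D.defect u v + newDefect u v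
        quads⁺ {u} {v} e with adj-cases e
        ... | inj₁ k with quads-InK k
        ...   | inj₁ q = inj₁ q
        ...   | inj₂ d = inj₂ (m≤n⇒m≤o+n (D.defect u v) d)
        quads⁺ {u} {v} e | inj₂ r with D.quads r
        ...   | inj₁ (q , q′) = inj₁ (Quad⁺ q , Quad⁺ q′)
        ...   | inj₂ d = inj₂ (m≤n⇒m≤n+o (newDefect u v) d)

  -- Greedy decomposition and the number of bad edges

  module _ (N s : ℕ) .{{_ : NonZero N}} .{{_ : NonZero s}} {m : ℕ} (large : 2 ^ (8 * s * N) ≤ m) where

    -- The degree sum is a potential. A copy adds 8s to the defect, hence 16Ns² on the left, and
    -- lowers the potential by at least 2s², which at rate 8N pays for it exactly. The term sm² pays
    -- for the sparse graph at the end. `k` is fuel for the recursion.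
    drawing : ∀ k (G : SimpleGraph m) → degreeSum G < k →
      Σ (Drawing G) λ D → 2 * N * s * ∬ (Drawing.defect D) ≤ s * (m * m) + 8 * N * degreeSum G
    drawing (suc k) G (s≤s deg≤k) with biclique-or-sparse N s large G
    ... | inj₂ sparse = trivialDrawing G , (begin
      2 * N * s * degreeSum G                ≡⟨ swap N s (degreeSum G) ⟩
      s * (2 * N * degreeSum G)              ≤⟨ *-monoʳ-≤ s sparse ⟩
      s * (m * m)                            ≤⟨ m≤m+n _ _ ⟩
      s * (m * m) + 8 * N * degreeSum G      ∎)
      where
      open ≤-Reasoning
      swap : ∀ N s d → 2 * N * s * d ≡ s * (2 * N * d)
      swap = solve-∀
    ... | inj₁ K with drawing k rest (<-≤-trans smaller deg≤k)
      where
      open BicliqueRemoval K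
      smaller : degreeSum rest < degreeSum G
      smaller = <-≤-trans (m<m+n _ (>-nonZero⁻¹ (2 * (s * s)) {{m*n≢0 2 (s * s) {{_}} {{m*n≢0 s s}}}})) degreeSum-rest
    ...   | D , bound = extend D , (begin
      2 * N * s * ∬ (Drawing.defect (extend D))
        ≡⟨ cong (2 * N * s *_) (trans (∬-distrib-+ {m} (Drawing.defect D) newDefect) (cong (∬ (Drawing.defect D) +_) ∬-newDefect)) ⟩
      2 * N * s * (∬ (Drawing.defect D) + 8 * s)
        ≡⟨ expand N s (∬ (Drawing.defect D)) ⟩
      2 * N * s * ∬ (Drawing.defect D) + 16 * N * (s * s)
        ≤⟨ +-monoˡ-≤ _ bound ⟩
      s * (m * m) + 8 * N * degreeSum rest + 16 * N * (s * s)
        ≡⟨ collect N s (m * m) (degreeSum rest) ⟩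
      s * (m * m) + 8 * N * (degreeSum rest + 2 * (s * s))
        ≤⟨ +-monoʳ-≤ (s * (m * m)) (*-monoʳ-≤ (8 * N) degreeSum-rest) ⟩
      s * (m * m) + 8 * N * degreeSum G ∎)
      where
      open BicliqueRemoval K
      open ≤-Reasoning
      expand : ∀ N s d → 2 * N * s * (d + 8 * s) ≡ 2 * N * s * d + 16 * N * (s * s)
      expand = solve-∀
      collect : ∀ N s q d → s * q + 8 * N * d + 16 * N * (s * s) ≡ s * q + 8 * N * (d + 2 * (s * s))
      collect = solve-∀

  -- An edge is listed once, with increasing ends, and charged to that dart alone: where its defect
  -- vanishes, `quads` puts both darts of the edge on quadrangular faces.
  length-badEdges≤ : ∀ {G : SimpleGraph m} (D : Drawing G) →
    length (badEdges (rotation (Drawing.enumeration D))) ≤ ∬ (Drawing.defect D)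
  length-badEdges≤ {m} {G} D = begin
    length (badEdges R)
      ≡⟨ length-filter-concatMap bad? _ (allFin m) ⟩
    _ ≡⟨ ∑-cong (allFin m) (λ u → length-filter-concatMap bad? _ (allFin m)) ⟩
    ∬ {m} (λ u v → length (filter bad? (if adj G u v ∧ ⌊ toℕ u <? toℕ v ⌋ then (u , v) ∷ [] else [])))
      ≤⟨ ∬-mono {m} pointwise ⟩
    ∬ defect ∎
    where
    open ≤-Reasoning
    open Drawing D
    R = rotation enumeration
    isBad : Dart m → Bool
    isBad e = not (onQuadFace R e ∧ onQuadFace R (proj₂ e , proj₁ e))
    bad? : ∀ e → Dec (isBad e ≡ true)
    bad? e = isBad e Bool.≟ true
    pointwise : ∀ u v → length (filter bad? (if adj G u v ∧ ⌊ toℕ u <? toℕ v ⌋ then (u , v) ∷ [] else [])) ≤ defect u v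
    pointwise u v with adj G u v in e | ⌊ toℕ u <? toℕ v ⌋
    ... | false | _     = z≤n
    ... | true  | false = z≤n
    ... | true  | true with isBad (u , v) Bool.≟ true
    ...   | no _  = z≤n
    ...   | yes bad with quads e
    ...     | inj₂ d = d
    ...     | inj₁ (q , q′) rewrite Quad⇒onQuadFace enumeration q | Quad⇒onQuadFace enumeration q′ with () ← bad

  few-badEdges : ∀ N .{{_ : NonZero N}} → ∃[ m₀ ] (∀ {m} → m₀ ≤ m → (G : SimpleGraph m) →
                 Σ (Rotation G) λ R → N * length (badEdges R) ≤ m * m)
  few-badEdges N = 2 ^ (8 * s * N) , λ {m} large G →
    let D , bound = drawing N s large (suc (degreeSum G)) G ≤-refl
    in rotation (Drawing.enumeration D) , *-cancelˡ-≤ (2 * s) (begin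
      2 * s * (N * length (badEdges (rotation (Drawing.enumeration D))))
        ≤⟨ *-monoʳ-≤ (2 * s) (*-monoʳ-≤ N (length-badEdges≤ D)) ⟩
      2 * s * (N * ∬ (Drawing.defect D))  ≡⟨ swap s N (∬ (Drawing.defect D)) ⟩
      2 * N * s * ∬ (Drawing.defect D)    ≤⟨ bound ⟩
      s * (m * m) + s * degreeSum G       ≤⟨ +-monoʳ-≤ (s * (m * m)) (*-monoʳ-≤ s (∬-𝟙≤ (adj G))) ⟩
      s * (m * m) + s * (m * m)           ≡⟨ double s (m * m) ⟩
      2 * s * (m * m)                     ∎)
    where
    open ≤-Reasoning
    -- Balances the two losses: the border term `8 * N * degreeSum G` becomes `s * degreeSum G`, at
    -- most `s * (m * m)`, like the term for the sparse remainder.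
    s = 8 * N
    instance
      s≢0 : NonZero s
      s≢0 = m*n≢0 8 N
      2s≢0 : NonZero (2 * s)
      2s≢0 = m*n≢0 2 s
    swap : ∀ s N d → 2 * s * (N * d) ≡ 2 * N * s * d
    swap = solve-∀
    double : ∀ s q → s * q + s * q ≡ 2 * s * q
    double = solve-∀

open import Data.Integer as ℤ using (+_; +[1+_])
import Data.Integer.Properties as ℤ
open import Data.Integer.Tactic.RingSolver using () renaming (solve-∀ to ℤ-solve-∀)
open import Data.Rational using (ℚ; mkℚ; 0ℚ; 1ℚ; ½; _<_; _≤_; _+_; _*_; -_; _-_; _/_; ∣_∣; NonNegative; nonNegative; positive; toℚᵘ)
open import Data.Rational.Properties
open import Data.Rational.Solver using (module +-*-Solver)
open import Data.Rational.Unnormalised as ℚᵘ using (ℚᵘ; mkℚᵘ; *≡*; *≤*)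
import Data.Rational.Unnormalised.Properties as ℚᵘ
open import Data.Vec as Vec using ([]; _∷_)
open import Data.Vec.Properties using (lookup∘tabulate)

-- Cut distance and the number of edges

-- `_/_` divides by a gcd and is stuck on variables; among unnormalised rationals the same
-- identities are identities of integers.
ℕtoℚᵘ : ℕ → ℚᵘ
ℕtoℚᵘ k = mkℚᵘ (+ k) 0

toℚᵘ-ℕtoℚ : ∀ k → toℚᵘ (ℕtoℚ k) ℚᵘ.≃ ℕtoℚᵘ k
toℚᵘ-ℕtoℚ k = toℚᵘ-fromℚᵘ (ℕtoℚᵘ k)

ℕtoℚ-+ : ∀ j k → ℕtoℚ (j ℕ.+ k) ≡ ℕtoℚ j + ℕtoℚ k
ℕtoℚ-+ j k = toℚᵘ-injective (begin-equality
  toℚᵘ (ℕtoℚ (j ℕ.+ k))               ≃⟨ toℚᵘ-ℕtoℚ (j ℕ.+ k) ⟩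
  ℕtoℚᵘ (j ℕ.+ k)                      ≃⟨ *≡* (identity (+ j) (+ k)) ⟩
  ℕtoℚᵘ j ℚᵘ.+ ℕtoℚᵘ k                 ≃⟨ ℚᵘ.+-cong (toℚᵘ-ℕtoℚ j) (toℚᵘ-ℕtoℚ k) ⟨
  toℚᵘ (ℕtoℚ j) ℚᵘ.+ toℚᵘ (ℕtoℚ k)    ≃⟨ toℚᵘ-homo-+ (ℕtoℚ j) (ℕtoℚ k) ⟨
  toℚᵘ (ℕtoℚ j + ℕtoℚ k)              ∎)
  where
  open ℚᵘ.≤-Reasoning
  identity : ∀ x y → (x ℤ.+ y) ℤ.* (+ 1) ≡ (x ℤ.* (+ 1) ℤ.+ y ℤ.* (+ 1)) ℤ.* (+ 1)
  identity = ℤ-solve-∀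

ℕtoℚ-* : ∀ j k → ℕtoℚ (j ℕ.* k) ≡ ℕtoℚ j * ℕtoℚ k
ℕtoℚ-* j k = toℚᵘ-injective (begin-equality
  toℚᵘ (ℕtoℚ (j ℕ.* k))               ≃⟨ toℚᵘ-ℕtoℚ (j ℕ.* k) ⟩
  ℕtoℚᵘ (j ℕ.* k)                      ≃⟨ *≡* (cong (ℤ._* (+ 1)) (ℤ.pos-* j k)) ⟩
  ℕtoℚᵘ j ℚᵘ.* ℕtoℚᵘ k                 ≃⟨ ℚᵘ.*-cong (toℚᵘ-ℕtoℚ j) (toℚᵘ-ℕtoℚ k) ⟨
  toℚᵘ (ℕtoℚ j) ℚᵘ.* toℚᵘ (ℕtoℚ k)    ≃⟨ toℚᵘ-homo-* (ℕtoℚ j) (ℕtoℚ k) ⟨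
  toℚᵘ (ℕtoℚ j * ℕtoℚ k)              ∎)
  where open ℚᵘ.≤-Reasoning

ℕtoℚ-mono : ∀ {j k} → j ℕ.≤ k → ℕtoℚ j ≤ ℕtoℚ k
ℕtoℚ-mono {j} {k} j≤k = toℚᵘ-cancel-≤ (begin
  toℚᵘ (ℕtoℚ j)  ≃⟨ toℚᵘ-ℕtoℚ j ⟩
  ℕtoℚᵘ j        ≤⟨ *≤* (ℤ.*-monoʳ-≤-nonNeg (+ 1) (ℤ.+≤+ j≤k)) ⟩
  ℕtoℚᵘ k        ≃⟨ toℚᵘ-ℕtoℚ k ⟨
  toℚᵘ (ℕtoℚ k)  ∎)
  where open ℚᵘ.≤-Reasoning

ℕtoℚ-nonNeg : ∀ k → NonNegative (ℕtoℚ k)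
ℕtoℚ-nonNeg k = nonNegative (ℕtoℚ-mono {0} {k} ℕ.z≤n)

reciprocal : ∀ k .{{_ : NonZero k}} → (+ 1 / k) * ℕtoℚ k ≡ 1ℚ
reciprocal k@(suc k-1) = toℚᵘ-injective (begin-equality
  toℚᵘ ((+ 1 / k) * ℕtoℚ k)             ≃⟨ toℚᵘ-homo-* (+ 1 / k) (ℕtoℚ k) ⟩
  toℚᵘ (+ 1 / k) ℚᵘ.* toℚᵘ (ℕtoℚ k)    ≃⟨ ℚᵘ.*-cong (toℚᵘ-fromℚᵘ (mkℚᵘ (+ 1) k-1)) (toℚᵘ-ℕtoℚ k) ⟩
  mkℚᵘ (+ 1) k-1 ℚᵘ.* ℕtoℚᵘ k          ≃⟨ *≡* (identity (+ k)) ⟩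
  toℚᵘ 1ℚ                               ∎)
  where
  open ℚᵘ.≤-Reasoning
  identity : ∀ x → ((+ 1) ℤ.* x) ℤ.* (+ 1) ≡ (+ 1) ℤ.* (x ℤ.* (+ 1))
  identity = ℤ-solve-∀

-- A positive rational times its denominator is its numerator, which is at least 1; so the
-- denominator serves as `N`.
archimedean : ∀ r → 0ℚ < r → ∃[ N ] ℕ.NonZero N × 1ℚ ≤ ℕtoℚ N * r
archimedean r 0<r with positive 0<r
archimedean r@(mkℚ +[1+ k ] d _) 0<r | _ = suc d , _ , toℚᵘ-cancel-≤ (begin
  toℚᵘ 1ℚ                                  ≤⟨ *≤* (ℤ.+≤+ bound) ⟩
  ℕtoℚᵘ (suc d) ℚᵘ.* toℚᵘ r               ≃⟨ ℚᵘ.*-congʳ {toℚᵘ r} (toℚᵘ-ℕtoℚ (suc d)) ⟨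
  toℚᵘ (ℕtoℚ (suc d)) ℚᵘ.* toℚᵘ r         ≃⟨ toℚᵘ-homo-* (ℕtoℚ (suc d)) r ⟨
  toℚᵘ (ℕtoℚ (suc d) * r)                 ∎)
  where
  open ℚᵘ.≤-Reasoning
  bound : 1 ℕ.* (1 ℕ.* suc d) ℕ.≤ suc d ℕ.* suc k ℕ.* 1
  bound = ℕ.≤-trans (ℕ.≤-reflexive (identity (suc d))) (ℕ.*-monoˡ-≤ 1 (ℕ.*-monoʳ-≤ (suc d) (ℕ.s≤s (ℕ.z≤n {k}))))
    where
    identity : ∀ x → 1 ℕ.* (1 ℕ.* x) ≡ x ℕ.* 1 ℕ.* 1
    identity = solve-∀

-- Moves sums of weights to ℕ. Keeping the weight `c`, which will be `p` or `1ℚ`, as a factor lets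
-- the lemma be applied to the inner and then to the outer sum of `eW`.
sumℚ-∑ : ∀ (l : List A) {h : A → ℚ} {f : A → ℕ} c → (∀ x → h x ≡ ℕtoℚ (f x) * c) →
         sumℚ (map h l) ≡ ℕtoℚ (∑ l f) * c
sumℚ-∑ []      c _ = ≡.sym (*-zeroˡ c)
sumℚ-∑ (x ∷ l) {h} {f} c h≡ = begin
  h x + sumℚ (map h l)                     ≡⟨ cong₂ _+_ (h≡ x) (sumℚ-∑ l c h≡) ⟩
  ℕtoℚ (f x) * c + ℕtoℚ (∑ l f) * c        ≡⟨ *-distribʳ-+ c (ℕtoℚ (f x)) (ℕtoℚ (∑ l f)) ⟨
  (ℕtoℚ (f x) + ℕtoℚ (∑ l f)) * c          ≡⟨ cong (_* c) (ℕtoℚ-+ (f x) (∑ l f)) ⟨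
  ℕtoℚ (f x ℕ.+ ∑ l f) * c                 ∎
  where open ≡.≡-Reasoning

eW-∬ : ∀ (w : WGraph m) U W {f : Fin m → Fin m → ℕ} c →
       (∀ u v → (if Vec.lookup U u ∧ Vec.lookup W v then w u v else 0ℚ) ≡ ℕtoℚ (f u v) * c) →
       eW w U W ≡ ℕtoℚ (∬ f) * c
eW-∬ {m} w U W c eq = sumℚ-∑ (allFin m) c (λ u → sumℚ-∑ (allFin m) c (eq u))

∈-allSubsets : (U : Subset m) → U ∈ allSubsets m
∈-allSubsets []       = here refl
∈-allSubsets (b ∷ U) = ∈-concatMap⁺ _ (lose (∈-allSubsets U) (∈-pair b))
  where
  ∈-pair : ∀ b → (b ∷ U) ∈ (true ∷ U) ∷ (false ∷ U) ∷ []
  ∈-pair true  = here refl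
  ∈-pair false = there (here refl)

∈⇒≤maxℚ : ∀ {x l} → x ∈ l → x ≤ maxℚ l
∈⇒≤maxℚ {l = _ ∷ l} (here refl) = p≤p⊔q _ (maxℚ l)
∈⇒≤maxℚ {l = y ∷ l} (there x∈)  = ≤-trans (∈⇒≤maxℚ x∈) (p≤q⊔p y (maxℚ l))

divBySq<⇒< : ∀ m .{{_ : NonZero m}} {x ε} → divBySq m x < ε → x < ε * ℕtoℚ (m ℕ.* m)
divBySq<⇒< m@(suc _) {x} {ε} lt = begin-strict
  x                                            ≡⟨ *-identityʳ x ⟨
  x * 1ℚ                                       ≡⟨ cong (x *_) (reciprocal (m ℕ.* m)) ⟨
  x * ((+ 1 / (m ℕ.* m)) * ℕtoℚ (m ℕ.* m))     ≡⟨ *-assoc x _ _ ⟨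
  divBySq m x * ℕtoℚ (m ℕ.* m)                 <⟨ *-monoˡ-<-pos (ℕtoℚ (m ℕ.* m)) {{positive (ℕtoℚ-pos (m ℕ.* m))}} lt ⟩
  ε * ℕtoℚ (m ℕ.* m)                           ∎
  where
  open ≤-Reasoning
  ℕtoℚ-pos : ∀ k .{{_ : NonZero k}} → 0ℚ < ℕtoℚ k
  ℕtoℚ-pos (suc k) = <-≤-trans (positive⁻¹ 1ℚ) (ℕtoℚ-mono {1} {suc k} (ℕ.s≤s ℕ.z≤n))

cutDist<⇒< : ∀ .{{_ : NonZero m}} (g h : WGraph m) {ε} → cutDist g h < ε → ∀ U W →
             ∣ eW g U W - eW h U W ∣ < ε * ℕtoℚ (m ℕ.* m)
cutDist<⇒< {m} g h lt U W = ≤-<-trans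
  (∈⇒≤maxℚ (∈-concatMap⁺ _ (lose (∈-allSubsets U) (∈-map⁺ _ (∈-allSubsets W)))))
  (divBySq<⇒< m lt)

p≤∣p∣ : ∀ p → p ≤ ∣ p ∣
p≤∣p∣ p with ∣p∣≡p∨∣p∣≡-p p
... | inj₁ e = ≤-reflexive (≡.sym e)
... | inj₂ e = ≤-trans p≤0 (0≤∣p∣ p)
  where
  p≤0 : p ≤ 0ℚ
  p≤0 = subst₂ _≤_ (+-identityʳ p) (+-inverseʳ p) (+-monoʳ-≤ p (subst (0ℚ ≤_) e (0≤∣p∣ p)))

q≤p+∣p-q∣ : ∀ p q → q ≤ p + ∣ p - q ∣
q≤p+∣p-q∣ p q = begin
  q                  ≡⟨ identity p q ⟩
  p + - (p - q)      ≤⟨ +-monoʳ-≤ p (p≤∣p∣ (- (p - q))) ⟩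
  p + ∣ - (p - q) ∣  ≡⟨ cong (λ r → p + r) (∣-p∣≡∣p∣ (p - q)) ⟩
  p + ∣ p - q ∣      ∎
  where
  open ≤-Reasoning
  open +-*-Solver
  identity : ∀ p q → q ≡ p + - (p - q)
  identity = solve 2 (λ p q → q := p :+ (:- (p :- q))) refl

-- Stated with `_<ᵇ_`, which reduces under `suc`, and with separate `a` and `b`, so that the
-- induction can lower `a` alone.
∑-below : ∀ a b → ∑ (allFin (a ℕ.+ b)) (λ i → 𝟙 (toℕ i ℕ.<ᵇ a)) ≡ a
∑-below zero    b = ∑-0 (allFin b)
∑-below (suc a) b = cong suc (trans (∑-tabulate {k = a ℕ.+ b} Fin.suc (λ i → 𝟙 (toℕ i ℕ.<ᵇ suc a))) (∑-below a b))

∑-above : ∀ a b → ∑ (allFin (a ℕ.+ b)) (λ i → 𝟙 (not (toℕ i ℕ.<ᵇ a))) ≡ b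
∑-above zero    b = trans (∑-const (allFin b) 1) (trans (ℕ.*-identityʳ _) (length-allFin b))
∑-above (suc a) b = trans (∑-tabulate {k = a ℕ.+ b} Fin.suc (λ i → 𝟙 (not (toℕ i ℕ.<ᵇ suc a)))) (∑-above a b)

module _ (n : ℕ) where

  V₁ V₂ : Subset (n ℕ.+ n)
  V₁ = Vec.tabulate (inV₁ {n})
  V₂ = Vec.tabulate (not ∘ inV₁ {n})

  inV₁≡<ᵇ : ∀ u → inV₁ {n} u ≡ (toℕ u ℕ.<ᵇ n)
  inV₁≡<ᵇ u = isYes≗does (toℕ u ℕ.<? n)

  eW-Kbip : ∀ p → eW (Kbip n p) V₁ V₂ ≡ ℕtoℚ (n ℕ.* n) * p
  eW-Kbip p = trans (eW-∬ (Kbip n p) V₁ V₂ p pointwise) (cong (λ k → ℕtoℚ k * p) count)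
    where
    cross : Fin (n ℕ.+ n) → Fin (n ℕ.+ n) → ℕ
    cross u v = 𝟙 (inV₁ {n} u) ℕ.* 𝟙 (not (inV₁ {n} v))
    pointwise : ∀ u v → (if Vec.lookup V₁ u ∧ Vec.lookup V₂ v then Kbip n p u v else 0ℚ) ≡ ℕtoℚ (cross u v) * p
    pointwise u v = trans
      (cong₂ (λ x y → if x ∧ y then Kbip n p u v else 0ℚ)
        (lookup∘tabulate (inV₁ {n}) u) (lookup∘tabulate (not ∘ inV₁ {n}) v))
      (cases (inV₁ {n} u) (inV₁ {n} v))
      where
      cases : ∀ x y → (if x ∧ not y then (if (x ∧ not y) ∨ (y ∧ not x) then p else 0ℚ) else 0ℚ) ≡
                      ℕtoℚ (𝟙 x ℕ.* 𝟙 (not y)) * p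
      cases true  true  = ≡.sym (*-zeroˡ p)
      cases true  false = ≡.sym (*-identityˡ p)
      cases false _     = ≡.sym (*-zeroˡ p)
    count : ∬ cross ≡ n ℕ.* n
    count = trans (∬-product (𝟙 ∘ inV₁ {n}) (𝟙 ∘ not ∘ inV₁ {n})) (cong₂ ℕ._*_
      (trans (∑-cong (allFin (n ℕ.+ n)) (cong 𝟙 ∘ inV₁≡<ᵇ)) (∑-below n n))
      (trans (∑-cong (allFin (n ℕ.+ n)) (cong (𝟙 ∘ not) ∘ inV₁≡<ᵇ)) (∑-above n n)))

  -- An edge from `u` in V₁ to `v` in V₂ has `toℕ u` below `n` and `toℕ v` not below it, so
  -- `edgeList` contains it in this very orientation.
  eW-graph≤ : ∀ (G : SimpleGraph (n ℕ.+ n)) → eW (weightOf G) V₁ V₂ ≤ ℕtoℚ (length (edgeList G))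
  eW-graph≤ G = begin
    eW (weightOf G) V₁ V₂          ≡⟨ eW-∬ (weightOf G) V₁ V₂ 1ℚ weights ⟩
    ℕtoℚ (∬ cross) * 1ℚ            ≡⟨ *-identityʳ _ ⟩
    ℕtoℚ (∬ cross)                 ≤⟨ ℕtoℚ-mono (ℕ.≤-trans (∬-mono {n ℕ.+ n} pointwise) (ℕ.≤-reflexive (≡.sym count))) ⟩
    ℕtoℚ (length (edgeList G))     ∎
    where
    open ≤-Reasoning
    cross : Fin (n ℕ.+ n) → Fin (n ℕ.+ n) → ℕ
    cross u v = 𝟙 ((inV₁ {n} u ∧ not (inV₁ {n} v)) ∧ adj G u v)
    entry : Fin (n ℕ.+ n) → Fin (n ℕ.+ n) → List (Dart (n ℕ.+ n))
    entry u v = if adj G u v ∧ ⌊ toℕ u ℕ.<? toℕ v ⌋ then (u , v) ∷ [] else []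
    weights : ∀ u v → (if Vec.lookup V₁ u ∧ Vec.lookup V₂ v then weightOf G u v else 0ℚ) ≡ ℕtoℚ (cross u v) * 1ℚ
    weights u v = trans
      (cong₂ (λ x y → if x ∧ y then weightOf G u v else 0ℚ)
        (lookup∘tabulate (inV₁ {n}) u) (lookup∘tabulate (not ∘ inV₁ {n}) v))
      (cases (inV₁ {n} u ∧ not (inV₁ {n} v)) (adj G u v))
      where
      cases : ∀ x y → (if x then (if y then 1ℚ else 0ℚ) else 0ℚ) ≡ ℕtoℚ (𝟙 (x ∧ y)) * 1ℚ
      cases false _     = refl
      cases true  false = refl
      cases true  true  = refl
    count : length (edgeList G) ≡ ∬ (λ u v → length (entry u v))
    count = trans (length-concatMap _ (allFin (n ℕ.+ n)))
                  (∑-cong (allFin (n ℕ.+ n)) (λ u → length-concatMap (entry u) (allFin (n ℕ.+ n))))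
    pointwise : ∀ u v → cross u v ℕ.≤ length (entry u v)
    pointwise u v with toℕ u ℕ.<? n | toℕ v ℕ.<? n | adj G u v | toℕ u ℕ.<? toℕ v
    ... | no _    | _      | _     | _     = ℕ.z≤n
    ... | yes _   | yes _  | _     | _     = ℕ.z≤n
    ... | yes _   | no _   | false | _     = ℕ.z≤n
    ... | yes _   | no _   | true  | yes _ = ℕ.≤-refl
    ... | yes u<n | no v≮n | true  | no u≮v = ⊥-elim (u≮v (ℕ.<-≤-trans u<n (ℕ.≮⇒≥ v≮n)))

-- The constants and the final estimate

^ℚ≤1 : ∀ q → 0ℚ ≤ q → q ≤ 1ℚ → ∀ k → q ^ℚ k ≤ 1ℚ
^ℚ≤1 q 0≤q q≤1 zero    = ≤-refl
^ℚ≤1 q 0≤q q≤1 (suc k) = begin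
  q * (q ^ℚ k)  ≤⟨ *-monoˡ-≤-nonNeg q {{nonNegative 0≤q}} (^ℚ≤1 q 0≤q q≤1 k) ⟩
  q * 1ℚ        ≡⟨ *-identityʳ q ⟩
  q             ≤⟨ q≤1 ⟩
  1ℚ            ∎
  where open ≤-Reasoning

-- Fourteen factors are bounded by 1 and one of the other two by `½`. The value p/8 is the one for
-- which the cut error is at most half of the main term.
[p/4]^16≤p/8 : ∀ p → 0ℚ ≤ p → p ≤ 1ℚ → (p * (+ 1 / 4)) ^ℚ 16 ≤ p * (+ 1 / 8)
[p/4]^16≤p/8 p 0≤p p≤1 = begin
  q * (q * (q ^ℚ 14))          ≤⟨ *-monoˡ-≤-nonNeg q (*-monoˡ-≤-nonNeg q (^ℚ≤1 q 0≤q q≤1 14)) ⟩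
  q * (q * 1ℚ)                 ≡⟨ cong (q *_) (*-identityʳ q) ⟩
  q * q                        ≤⟨ *-monoˡ-≤-nonNeg q q≤½ ⟩
  q * ½                        ≡⟨ *-assoc p (+ 1 / 4) ½ ⟩
  p * (+ 1 / 8)                ∎
  where
  open ≤-Reasoning
  q = p * (+ 1 / 4)
  0≤q : 0ℚ ≤ q
  0≤q = subst (_≤ q) (*-zeroˡ (+ 1 / 4)) (*-monoʳ-≤-nonNeg (+ 1 / 4) 0≤p)
  instance
    q-nonNeg : NonNegative q
    q-nonNeg = nonNegative 0≤q
  q≤¼ : q ≤ + 1 / 4
  q≤¼ = subst (q ≤_) (*-identityˡ (+ 1 / 4)) (*-monoʳ-≤-nonNeg (+ 1 / 4) p≤1)
  q≤½ : q ≤ ½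
  q≤½ = ≤-trans q≤¼ (from-yes (+ 1 / 4 ≤? ½))
  q≤1 : q ≤ 1ℚ
  q≤1 = ≤-trans q≤½ (from-yes (½ ≤? 1ℚ))

t≤e+t/2⇒t≤2e : ∀ {t e} → t ≤ e + t * ½ → t ≤ ℕtoℚ 2 * e
t≤e+t/2⇒t≤2e {t} {e} le = begin
  t                                 ≡⟨ split t ⟩
  ℕtoℚ 2 * (t - t * ½)              ≤⟨ *-monoˡ-≤-nonNeg (ℕtoℚ 2) (+-monoˡ-≤ (- (t * ½)) le) ⟩
  ℕtoℚ 2 * (e + t * ½ - t * ½)      ≡⟨ cong (ℕtoℚ 2 *_) (cancel e (t * ½)) ⟩
  ℕtoℚ 2 * e                        ∎
  where
  open ≤-Reasoning
  open +-*-Solver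
  split : ∀ t → t ≡ ℕtoℚ 2 * (t - t * ½)
  split = solve 1 (λ t → t := con (ℕtoℚ 2) :* (t :- t :* con ½)) refl
  cancel : ∀ e x → e + x - x ≡ e
  cancel = solve 2 (λ e x → e :+ x :- x := e) refl

-- Test the cut distance on the two sides: the weighted graph has pn² there, and the error is less
-- than ε(2n)², at most pn²/2, so half of pn² remains.
InQ⇒many-edges : ∀ n .{{_ : NonZero n}} {p ε} → ε ≤ p * (+ 1 / 8) →
  (G : SimpleGraph (n ℕ.+ n)) → InQ n p ε G →
  ℕtoℚ (n ℕ.* n) * p ≤ ℕtoℚ 2 * ℕtoℚ (length (edgeList G))
InQ⇒many-edges n {p} {ε} ε≤p/8 G close = t≤e+t/2⇒t≤2e {ℕtoℚ (n ℕ.* n) * p} {E} (begin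
  ℕtoℚ (n ℕ.* n) * p                       ≡⟨ eW-Kbip n p ⟨
  eK                                       ≤⟨ q≤p+∣p-q∣ eG eK ⟩
  eG + ∣ eG - eK ∣                         ≤⟨ +-mono-≤ (eW-graph≤ n G) (<⇒≤ (cutDist<⇒< (weightOf G) (Kbip n p) close (V₁ n) (V₂ n))) ⟩
  E + ε * ℕtoℚ ((n ℕ.+ n) ℕ.* (n ℕ.+ n))   ≤⟨ +-monoʳ-≤ E (*-monoʳ-≤-nonNeg _ {{ℕtoℚ-nonNeg ((n ℕ.+ n) ℕ.* (n ℕ.+ n))}} ε≤p/8) ⟩
  E + p * (+ 1 / 8) * ℕtoℚ ((n ℕ.+ n) ℕ.* (n ℕ.+ n)) ≡⟨ cong (λ x → E + p * (+ 1 / 8) * x)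
                                                (trans (cong ℕtoℚ (square n)) (ℕtoℚ-* 4 (n ℕ.* n))) ⟩
  E + p * (+ 1 / 8) * (ℕtoℚ 4 * ℕtoℚ (n ℕ.* n))      ≡⟨ cong (λ r → E + r) (regroup p (ℕtoℚ (n ℕ.* n))) ⟩
  E + ℕtoℚ (n ℕ.* n) * p * ½               ∎)
  where
  open ≤-Reasoning
  instance
    n+n≢0 : NonZero (n ℕ.+ n)
    n+n≢0 = ℕ.>-nonZero (ℕ.<-≤-trans (ℕ.>-nonZero⁻¹ n) (ℕ.m≤m+n n n))
  eG = eW (weightOf G) (V₁ n) (V₂ n)
  eK = eW (Kbip n p) (V₁ n) (V₂ n)
  E = ℕtoℚ (length (edgeList G))
  square : ∀ n → (n ℕ.+ n) ℕ.* (n ℕ.+ n) ≡ 4 ℕ.* (n ℕ.* n)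
  square = solve-∀
  open +-*-Solver
  regroup : ∀ p x → p * (+ 1 / 8) * (ℕtoℚ 4 * x) ≡ x * p * ½
  regroup = solve 2 (λ p x → p :* con (+ 1 / 8) :* (con (ℕtoℚ 4) :* x) := x :* p :* con ½) refl

-- Here `x` is n², and the 4 comes from |V|² = 4n². The chain would give 8εE; the slack up to 20εE
-- is spent in `4x≤10x`.
few-bad : ∀ p ε N x B E .{{_ : NonNegative ε}} .{{_ : NonNegative p}} .{{_ : NonNegative B}} .{{_ : NonNegative x}} →
  1ℚ ≤ N * (ε * p) → N * B ≤ ℕtoℚ 4 * x → x * p ≤ ℕtoℚ 2 * E → B ≤ ℕtoℚ 2 * (ℕtoℚ 10 * ε) * E
few-bad p ε N x B E 1≤Nεp NB≤4x xp≤2E = begin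
  B                                ≡⟨ *-identityˡ B ⟨
  1ℚ * B                           ≤⟨ *-monoʳ-≤-nonNeg B 1≤Nεp ⟩
  N * (ε * p) * B                  ≡⟨ regroup₁ N ε p B ⟩
  (ε * p) * (N * B)                ≤⟨ *-monoˡ-≤-nonNeg (ε * p) {{nonNeg*nonNeg⇒nonNeg ε p}} (≤-trans NB≤4x 4x≤10x) ⟩
  (ε * p) * (ℕtoℚ 10 * x)          ≡⟨ regroup₂ ε p x ⟩
  (ℕtoℚ 10 * ε) * (x * p)          ≤⟨ *-monoˡ-≤-nonNeg (ℕtoℚ 10 * ε) {{nonNeg*nonNeg⇒nonNeg (ℕtoℚ 10) ε}} xp≤2E ⟩
  (ℕtoℚ 10 * ε) * (ℕtoℚ 2 * E)     ≡⟨ regroup₃ (ℕtoℚ 2) (ℕtoℚ 10 * ε) E ⟩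
  ℕtoℚ 2 * (ℕtoℚ 10 * ε) * E       ∎
  where
  open ≤-Reasoning
  4x≤10x : ℕtoℚ 4 * x ≤ ℕtoℚ 10 * x
  4x≤10x = *-monoʳ-≤-nonNeg x (ℕtoℚ-mono {4} {10} (ℕ.m≤m+n 4 6))
  open +-*-Solver
  regroup₁ : ∀ N ε p B → N * (ε * p) * B ≡ (ε * p) * (N * B)
  regroup₁ = solve 4 (λ N ε p B → N :* (ε :* p) :* B := (ε :* p) :* (N :* B)) refl
  regroup₂ : ∀ ε p x → (ε * p) * (ℕtoℚ 10 * x) ≡ (ℕtoℚ 10 * ε) * (x * p)
  regroup₂ = solve 3 (λ ε p x → (ε :* p) :* (con (ℕtoℚ 10) :* x) := (con (ℕtoℚ 10) :* ε) :* (x :* p)) refl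
  regroup₃ : ∀ a b c → b * (a * c) ≡ a * b * c
  regroup₃ = solve 3 (λ a b c → b :* (a :* c) := a :* b :* c) refl

few-bad⇒NearQuadrangular : ∀ {p ε} N n {G : SimpleGraph (n ℕ.+ n)} (R : Rotation G) →
  0ℚ ≤ p → 0ℚ ≤ ε → 1ℚ ≤ ℕtoℚ N * (ε * p) →
  N ℕ.* length (badEdges R) ℕ.≤ (n ℕ.+ n) ℕ.* (n ℕ.+ n) →
  ℕtoℚ (n ℕ.* n) * p ≤ ℕtoℚ 2 * ℕtoℚ (length (edgeList G)) →
  NearQuadrangular R (ℕtoℚ 10 * ε)
few-bad⇒NearQuadrangular {p} {ε} N n {G} R 0≤p 0≤ε 1≤Nεp N*bad≤m² =
  few-bad p ε (ℕtoℚ N) (ℕtoℚ (n ℕ.* n)) (ℕtoℚ (length (badEdges R))) (ℕtoℚ (length (edgeList G)))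
    {{nonNegative 0≤ε}} {{nonNegative 0≤p}}
    {{ℕtoℚ-nonNeg (length (badEdges R))}} {{ℕtoℚ-nonNeg (n ℕ.* n)}}
    1≤Nεp
    (subst₂ _≤_ (ℕtoℚ-* N (length (badEdges R))) (ℕtoℚ-* 4 (n ℕ.* n))
      (ℕtoℚ-mono (ℕ.≤-trans N*bad≤m² (ℕ.≤-reflexive (square n)))))
  where
  square : ∀ n → (n ℕ.+ n) ℕ.* (n ℕ.+ n) ≡ 4 ℕ.* (n ℕ.* n)
  square = solve-∀

near-quadrangular : ∀ p ε → 0ℚ < p → 0ℚ < ε → ε ≤ p * (+ 1 / 8) →
  ∀ N → 1ℚ ≤ ℕtoℚ N * (ε * p) →
  ∀ m₀ → (∀ {m} → m₀ ℕ.≤ m → (G : SimpleGraph m) → Σ (Rotation G) λ R → N ℕ.* length (badEdges R) ℕ.≤ m ℕ.* m) →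
  (n : ℕ) → suc m₀ ℕ.≤ n → (G : SimpleGraph (n ℕ.+ n)) → InQ n p ε G →
  Σ (Rotation G) (λ R → NearQuadrangular R (ℕtoℚ 10 * ε))
near-quadrangular p ε 0<p 0<ε ε≤p/8 N 1≤Nεp m₀ embed n m₀<n G close =
  proj₁ drawn , few-bad⇒NearQuadrangular {p} {ε} N n (proj₁ drawn) (<⇒≤ 0<p) (<⇒≤ 0<ε) 1≤Nεp (proj₂ drawn)
    -- Asking for `suc m₀` makes `n` nonzero, so that the normalisation of the cut distance is a
    -- true division.
    (InQ⇒many-edges n {{ℕ.>-nonZero (ℕ.≤-trans (ℕ.s≤s ℕ.z≤n) m₀<n)}} ε≤p/8 G close)
  where
  drawn = embed (ℕ.≤-trans (ℕ.n≤1+n m₀) (ℕ.≤-trans m₀<n (ℕ.m≤m+n n n))) G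

theorem3p9 : (p ε : ℚ) → 0ℚ < p → p Data.Rational.≤ 1ℚ → 0ℚ < ε → ε < (p * (+ 1 / 4)) ^ℚ 16 →
    ∃[ n₀ ] ((n : ℕ) → n₀ ℕ.≤ n → (G : SimpleGraph (n ℕ.+ n)) → InQ n p ε G →
    Σ (Rotation G) (λ R → NearQuadrangular R (ℕtoℚ 10 * ε)))
theorem3p9 p ε 0<p p≤1 0<ε ε<[p/4]^16 = suc (proj₁ embed) ,
  near-quadrangular p ε 0<p 0<ε (≤-trans (<⇒≤ ε<[p/4]^16) ([p/4]^16≤p/8 p (<⇒≤ 0<p) p≤1))
    (proj₁ N) (proj₂ (proj₂ N)) (proj₁ embed) (proj₂ embed)
  where
  0<εp : 0ℚ < ε * p
  0<εp = subst (_< ε * p) (*-zeroʳ ε) (*-monoʳ-<-pos ε {{positive 0<ε}} 0<p)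
  -- With `N` at least 1/(εp), a fraction 1/N of the m² pairs is at most 4εpn², which is comparable
  -- to ε times the number of edges.
  N = archimedean (ε * p) 0<εp
  embed = few-badEdges (proj₁ N) {{proj₁ (proj₂ N)}}
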